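{- Let $\Bbbk$ be a field and $G$ a graph that is prime over $\Bbbk$ with minimum degree $\delta(G)\ge 2$. Let $x\in V(G)$ and $N_G(x)=Y\cup Z$ be a partition with $Y\neq\emptyset$ and $Z\neq\emptyset$. Then $\mathcal{L}_x(G;Y,Z)$ is prime over $\Bbbk$.
   Context: $\operatorname{reg}_{\Bbbk}(G)=\max\{j\ge0:\widetilde H_{j-1}(\operatorname{Ind}(G[S]);\Bbbk)\neq0\text{ for some }S\subseteq V(G)\}$, $\operatorname{Ind}$ the independence complex. A connected graph $H$ is prime over $\Bbbk$ if $\operatorname{reg}_{\Bbbk}(H-v)<\operatorname{reg}_{\Bbbk}(H)$ for every vertex $v$. The Lozin transform $\mathcal{L}_x(G;Y,Z)$: delete $x$, add four new vertices $y,a,b,z$ with edges $ya,ab,bz$, and join $y$ to every vertex of $Y$ and $z$ to every vertex of $Z$. -}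

module Defs where

open import Algebra.Bundles using (CommutativeRing)
open import Data.Bool.Base using (if_then_else_)
open import Data.Fin.Base using (Fin; zero; suc)
open import Data.Fin.Properties using (_<?_)
open import Data.Fin.Subset using (Subset; inside; _∈_; _⊆_; _∪_; _∩_; _-_; ⁅_⁆; ∣_∣; Nonempty)
open import Data.Fin.Subset.Properties
  using (_∈?_; x∈p∩q⁺; p⊆p∪q; q⊆p∪q; x∈p∧x≢y⇒x∈p-y)
open import Data.List.Base using (allFin; filter; map)
open import Data.List.Extrema.Nat using (min)
open import Data.Nat.Base using (ℕ; suc; _≤_; _<_)
open import Data.Product.Base using (∃-syntax; _×_; _,_)
open import Data.Sum.Base using (inj₁; inj₂)
open import Data.Vec.Base using (_∷_; tabulate; here; there)
open import Data.Vec.Properties using ([]=⇒lookup; lookup∘tabulate)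
open import Level using (Level; _⊔_; 0ℓ) renaming (suc to lsuc)
open import Relation.Binary.Construct.Closure.ReflexiveTransitive using (Star)
open import Relation.Binary.Construct.Closure.Symmetric using (SymClosure; fwd; bwd; symmetric)
open import Relation.Binary.Core using (Rel)
open import Relation.Binary.Definitions using (Decidable; Symmetric; Irreflexive)
open import Relation.Binary.PropositionalEquality using (_≡_; refl; sym; trans; subst)
open import Relation.Nullary using (¬_; does; yes; no; _×-dec_; _⊎-dec_)
open import Relation.Nullary.Decidable using (map′)
open import Relation.Unary using (Pred)
import Algebra.Properties.Semiring.Exp as SemiringExp
import Algebra.Properties.Semiring.Sum as SemiringSum

private
  variable
    n : ℕ

record Field (c ℓ : Level) : Set (lsuc (c ⊔ ℓ)) where
  field
    commutativeRing : CommutativeRing c ℓ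
  open CommutativeRing commutativeRing public
  field
    1≉0     : ¬ (1# ≈ 0#)
    inverse : ∀ x → ¬ (x ≈ 0#) → ∃[ y ] x * y ≈ 1#

-- A finite simple graph whose vertex set is a subset of Fin n.  Keeping the
-- ambient Fin n fixed lets induced subgraphs and vertex deletions retain the
-- names of their vertices.
record Graph (n : ℕ) : Set₁ where
  infix 4 _~_ _~?_
  field
    V        : Subset n
    _~_      : Rel (Fin n) 0ℓ
    _~?_     : Decidable _~_
    ~-sym    : Symmetric _~_
    ~-irrefl : Irreflexive _≡_ _~_
    ~⇒∈V     : ∀ {u v} → u ~ v → u ∈ V

  N : Fin n → Subset n
  N u = tabulate (λ v → does (u ~? v))

  degree : Fin n → ℕ
  degree u = ∣ N u ∣

  -- Every degree is less than n when V is nonempty, so the default value n of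
  -- `min` matters only for the graph without vertices.
  δ : ℕ
  δ = min n (map degree (filter (_∈? V) (allFin n)))

open Graph using (V; N)

Connected : Graph n → Set
Connected G = Nonempty (V G) × (∀ {u v} → u ∈ V G → v ∈ V G → Star _~_ u v)
  where open Graph G using (_~_)

infix 8 _[_]

_[_] : Graph n → Subset n → Graph n
G [ S ] = record
  { V        = V G ∩ S
  ; _~_      = λ u v → u ~ v × u ∈ S × v ∈ S
  ; _~?_     = λ u v → (u ~? v) ×-dec ((u ∈? S) ×-dec (v ∈? S))
  ; ~-sym    = λ (e , p , q) → ~-sym e , q , p
  ; ~-irrefl = λ eq (e , _) → ~-irrefl eq e
  ; ~⇒∈V     = λ (e , p , _) → x∈p∩q⁺ (~⇒∈V e , p)
  }
  where open Graph G using (_~_; _~?_; ~-sym; ~-irrefl; ~⇒∈V)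

infixl 7 _∖_

_∖_ : Graph n → Fin n → Graph n
G ∖ v = G [ V G - v ]

-- A simplicial complex, given by its faces (including the empty face).
Complex : ℕ → Set₁
Complex n = Pred (Subset n) 0ℓ

Ind : Graph n → Complex n
Ind G σ = σ ⊆ V G × (∀ {u v} → u ∈ σ → v ∈ σ → ¬ (u ~ v))
  where open Graph G using (_~_)

below : Fin n → Subset n
below v = tabulate (λ u → does (u <? v))

module _ {c ℓ} (𝕜 : Field c ℓ) where
  open Field 𝕜 using (_≈_; 0#; 1#; _*_; -_; semiring) renaming (Carrier to K)
  open SemiringExp semiring using (_^_)
  open SemiringSum semiring using (sum)

  -- Degrees are shifted by one: a chain with j vertices per face lives in
  -- homological degree j - 1, so j = 0 is the augmentation degree -1.
  -- A chain is recorded by its coefficients; those outside the faces with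
  -- j vertices have to vanish.
  IsChain : Complex n → ℕ → (Subset n → K) → Set ℓ
  IsChain Δ j f = ∀ σ → ¬ (Δ σ × ∣ σ ∣ ≡ j) → f σ ≈ 0#

  -- The simplicial boundary ∂ {v₀ < … < vₖ} = Σᵢ (-1)ⁱ {v₀ , … , v̂ᵢ , … , vₖ},
  -- read off at τ: the face τ arises from τ ∪ {v} with v ∉ τ, and the position
  -- of v in τ ∪ {v} is the number of elements of τ below v.
  ∂ : (Subset n → K) → Subset n → K
  ∂ f τ = sum λ v → if does (v ∈? τ) then 0# else ((- 1#) ^ ∣ τ ∩ below v ∣) * f (τ ∪ ⁅ v ⁆)

  IsCycle : Complex n → ℕ → (Subset n → K) → Set ℓ
  IsCycle Δ j f = IsChain Δ j f × (∀ τ → ∂ f τ ≈ 0#)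

  IsBoundary : Complex n → ℕ → (Subset n → K) → Set (c ⊔ ℓ)
  IsBoundary Δ j f = ∃[ g ] IsChain Δ (suc j) g × (∀ τ → ∂ g τ ≈ f τ)

  -- H̃≢0 Δ j says that the reduced homology of Δ in degree j - 1, cycles modulo
  -- boundaries, is not zero.
  H̃≢0 : Complex n → ℕ → Set (c ⊔ ℓ)
  H̃≢0 Δ j = ∃[ f ] IsCycle Δ j f × ¬ IsBoundary Δ j f

  IsMax : ∀ {p} → Pred ℕ p → ℕ → Set p
  IsMax P m = P m × (∀ j → P j → j ≤ m)

  -- reg G ≐ r: the maximum defining the regularity of G exists and equals r.
  reg_≐_ : Graph n → ℕ → Set (c ⊔ ℓ)
  reg G ≐ r = IsMax (λ j → ∃[ S ] S ⊆ V G × H̃≢0 (Ind (G [ S ])) j) r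

  Prime : Graph n → Set (c ⊔ ℓ)
  Prime H = Connected H
          × (∀ v → v ∈ V H → ∃[ s ] ∃[ r ] (reg (H ∖ v) ≐ s) × (reg H ≐ r) × s < r)

-- The new vertices y, a, b, z come first, followed by the old names.
pattern 𝕪 = zero
pattern 𝕒 = suc zero
pattern 𝕓 = suc (suc zero)
pattern 𝕫 = suc (suc (suc zero))
pattern old u = suc (suc (suc (suc u)))

data LozinEdge (G : Graph n) (x : Fin n) (Y Z : Subset n) : Rel (Fin (suc (suc (suc (suc n))))) 0ℓ where
  ya : LozinEdge G x Y Z 𝕪 𝕒
  ab : LozinEdge G x Y Z 𝕒 𝕓
  bz : LozinEdge G x Y Z 𝕓 𝕫
  yY : ∀ {u} → u ∈ Y → LozinEdge G x Y Z 𝕪 (old u)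
  zZ : ∀ {u} → u ∈ Z → LozinEdge G x Y Z 𝕫 (old u)
  G∖x : ∀ {u v} → Graph._~_ (G ∖ x) u v → LozinEdge G x Y Z (old u) (old v)

lozinEdge? : (G : Graph n) (x : Fin n) (Y Z : Subset n) → Decidable (LozinEdge G x Y Z)
lozinEdge? G x Y Z 𝕪 𝕪 = no λ ()
lozinEdge? G x Y Z 𝕪 𝕒 = yes ya
lozinEdge? G x Y Z 𝕪 𝕓 = no λ ()
lozinEdge? G x Y Z 𝕪 𝕫 = no λ ()
lozinEdge? G x Y Z 𝕪 (old u) = map′ yY (λ { (yY p) → p }) (u ∈? Y)
lozinEdge? G x Y Z 𝕒 𝕪 = no λ ()
lozinEdge? G x Y Z 𝕒 𝕒 = no λ ()
lozinEdge? G x Y Z 𝕒 𝕓 = yes ab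
lozinEdge? G x Y Z 𝕒 𝕫 = no λ ()
lozinEdge? G x Y Z 𝕒 (old _) = no λ ()
lozinEdge? G x Y Z 𝕓 𝕪 = no λ ()
lozinEdge? G x Y Z 𝕓 𝕒 = no λ ()
lozinEdge? G x Y Z 𝕓 𝕓 = no λ ()
lozinEdge? G x Y Z 𝕓 𝕫 = yes bz
lozinEdge? G x Y Z 𝕓 (old _) = no λ ()
lozinEdge? G x Y Z 𝕫 𝕪 = no λ ()
lozinEdge? G x Y Z 𝕫 𝕒 = no λ ()
lozinEdge? G x Y Z 𝕫 𝕓 = no λ ()
lozinEdge? G x Y Z 𝕫 𝕫 = no λ ()
lozinEdge? G x Y Z 𝕫 (old u) = map′ zZ (λ { (zZ p) → p }) (u ∈? Z)
lozinEdge? G x Y Z (old _) 𝕪 = no λ ()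
lozinEdge? G x Y Z (old _) 𝕒 = no λ ()
lozinEdge? G x Y Z (old _) 𝕓 = no λ ()
lozinEdge? G x Y Z (old _) 𝕫 = no λ ()
lozinEdge? G x Y Z (old u) (old v) = map′ G∖x (λ { (G∖x e) → e }) (Graph._~?_ (G ∖ x) u v)

∈N⇒∈V∖x : (G : Graph n) {x u : Fin n} → u ∈ N G x → u ∈ V (G ∖ x)
∈N⇒∈V∖x G {x} {u} u∈N with Graph._~?_ G x u | trans (sym (lookup∘tabulate _ u)) ([]=⇒lookup u∈N)
... | yes x~u | _  = x∈p∩q⁺ (u∈V , x∈p∧x≢y⇒x∈p-y u∈V λ u≡x → Graph.~-irrefl G (sym u≡x) x~u)
  where u∈V = Graph.~⇒∈V G (Graph.~-sym G x~u)
... | no _    | ()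

Lozin : (G : Graph n) (x : Fin n) (Y Z : Subset n) → N G x ≡ Y ∪ Z → Graph (suc (suc (suc (suc n))))
Lozin G x Y Z N≡Y∪Z = record
  { V        = inside ∷ inside ∷ inside ∷ inside ∷ V (G ∖ x)
  ; _~_      = SymClosure (LozinEdge G x Y Z)
  ; _~?_     = λ u v → map′ (λ { (inj₁ e) → fwd e ; (inj₂ e) → bwd e })
                            (λ { (fwd e) → inj₁ e ; (bwd e) → inj₂ e })
                            (lozinEdge? G x Y Z u v ⊎-dec lozinEdge? G x Y Z v u)
  ; ~-sym    = symmetric _
  ; ~-irrefl = λ { refl (fwd e) → irrefl e ; refl (bwd e) → irrefl e }
  ; ~⇒∈V     = λ { (fwd e) → source e ; (bwd e) → target e }
  }
  where
  irrefl : ∀ {u} → ¬ LozinEdge G x Y Z u u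
  irrefl (G∖x e) = Graph.~-irrefl (G ∖ x) refl e

  lift : ∀ {u} → u ∈ V (G ∖ x) → old u ∈ (inside ∷ inside ∷ inside ∷ inside ∷ V (G ∖ x))
  lift p = there (there (there (there p)))

  source : ∀ {u v} → LozinEdge G x Y Z u v → u ∈ (inside ∷ inside ∷ inside ∷ inside ∷ V (G ∖ x))
  source ya      = here
  source ab      = there here
  source bz      = there (there here)
  source (yY _)  = here
  source (zZ _)  = there (there (there here))
  source (G∖x e) = lift (Graph.~⇒∈V (G ∖ x) e)

  target : ∀ {u v} → LozinEdge G x Y Z u v → v ∈ (inside ∷ inside ∷ inside ∷ inside ∷ V (G ∖ x))
  target ya      = there here
  target ab      = there (there here)
  target bz      = there (there (there here))
  target (yY p)  = lift (∈N⇒∈V∖x G (subst (_ ∈_) (sym N≡Y∪Z) (p⊆p∪q Z p)))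
  target (zZ p)  = lift (∈N⇒∈V∖x G (subst (_ ∈_) (sym N≡Y∪Z) (q⊆p∪q Y Z p)))
  target (G∖x e) = lift (Graph.~⇒∈V (G ∖ x) (Graph.~-sym (G ∖ x) e))

{-# OPTIONS --safe #-}

-- A chain on Ind(ℒ(G)) is a sum Σ t c_t over the independent sets t of the path yabz, with
-- the c_t chains on Ind(G - x).  The maps  Σ t c_t ↦ x c_yz + c_y + c_b  and
-- x g + h ↦ (b - a) h + (yz - yb - az) g  shift degrees by one, commute with ∂ up to sign on
-- cycles, and are mutually inverse on homology:  Ind(ℒ(G)) behaves as the suspension of
-- Ind(G).
--
-- Upper bounds.  Induced subgraphs of ℒ(G) without y or without z are handled by deleting
-- and linking a vertex, which shows reg Γ ≤ max (reg (Γ - v), 1 + reg (Γ - N[v])).  If y and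
-- z are present but a or b is not, adding the missing vertices does not kill the class; if
-- all are present the suspension applies.  Hence reg ℒ(G) ≤ 1 + reg G for every G, and the
-- same bound for G - u controls ℒ(G) - u.  For ℒ(G) - a, link z: by joining the edge bz, the
-- link of z embeds with a shift in degree into ℒ(G - u) for any u in Z.  This is where Y
-- and Z have to be nonempty.
--
-- Lower bounds.  As the decisive class of a prime graph G of regularity r + 1 lives on all
-- of V(G), every G - N[v] has a class in degree r, and a disjoint edge raises the degree
-- by one.  Witnesses of nonzero homology are always carried along, since over an arbitrary
-- field nothing decides whether homology vanishes.

module Submission where

open import Data.Bool.Base using (if_then_else_; true; false)
open import Data.Empty using (⊥-elim)
open import Data.Fin.Base using (Fin; zero; suc)
open import Data.Fin.Patterns using (0F; 1F; 2F; 3F; 4F; 5F)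
open import Data.Fin.Properties using (_≟_)
open import Data.Fin.Subset
  using (Subset; Side; inside; outside; _∈_; _∉_; _⊆_; _∪_; _∩_; ⁅_⁆; ∣_∣; ∁; Nonempty; Empty)
  renaming (⊥ to ∅; _-_ to _∸ˢ_)
open import Data.Fin.Subset.Properties
  using (_∈?_; ∪-identityʳ; x∈p∩q⁺; x∈p∩q⁻; x∈p∪q⁺; x∈p∪q⁻; x∈∁p⇒x∉p;
         x∉p⇒x∈∁p; x∈p∧x≢y⇒x∈p-y; drop-there; ⊆-antisym)
open import Data.Nat.Base as ℕ using (ℕ; zero; suc; _≤_; z≤n; s≤s)
open import Data.Nat.Properties
  using (suc-injective; ≤-refl; ≤-trans; ≤-pred; _≤?_; 1+n≰n; m≤n⇒m≤1+n)
open import Data.Product.Base using (∃-syntax; _×_; _,_; proj₁; proj₂)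
open import Data.Sum.Base using (_⊎_; inj₁; inj₂; [_,_]′)
open import Data.Vec.Base using (Vec; []; _∷_; here; there; tabulate; lookup; replicate; zipWith; _[_]≔_)
open import Data.Vec.Properties
  using ([]=⇒lookup; lookup⇒[]=; lookup∘tabulate; updateAt-minimal; lookup∘updateAt′)
open import Function.Base using (_∘_; case_of_)
open import Level using (Level; _⊔_)
open import Relation.Binary.Construct.Closure.ReflexiveTransitive using (Star; ε; _◅_; _◅◅_; reverse)
open import Relation.Binary.Construct.Closure.Symmetric using (fwd; bwd)
open import Relation.Binary.PropositionalEquality as ≡ using (_≡_; _≢_)
open import Relation.Nullary using (¬_; does; yes; no)
open import Relation.Nullary.Decidable using (dec-true)
open import Defs
open Graph using (V; N)
import Algebra.Properties.CommutativeMonoid.Sum as Sum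
import Algebra.Properties.Monoid.Mult as Mult
import Algebra.Properties.Ring as RingProperties
import Algebra.Properties.Semiring.Exp as SemiringExp
import Relation.Binary.Reasoning.Setoid as SetoidReasoning

private
  variable
    m n : ℕ

-- No vertex lies below vertex zero, so this count makes the sign of vertex zero in `∂` equal to
-- `1#`.
∩-none : (τ : Subset n) → ∣ τ ∩ tabulate (λ _ → false) ∣ ≡ 0
∩-none []            = ≡.refl
∩-none (inside  ∷ τ) = ∩-none τ
∩-none (outside ∷ τ) = ∩-none τ

-- Inserting and deleting a vertex in a finite subset

infixl 7 _⁺_ _⁻_

_⁺_ _⁻_ : Subset n → Fin n → Subset n
S ⁺ v = S [ v ]≔ inside
S ⁻ v = S [ v ]≔ outside

v∈S⁺v : (v : Fin n) (S : Subset n) → v ∈ S ⁺ v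
v∈S⁺v zero    (s ∷ S) = here
v∈S⁺v (suc v) (s ∷ S) = there (v∈S⁺v v S)

v∉S⁻v : (v : Fin n) (S : Subset n) → v ∉ S ⁻ v
v∉S⁻v (suc v) (s ∷ S) (there p) = v∉S⁻v v S p

∈⁺⇒≡∨∈ : {v u : Fin n} {S : Subset n} → u ∈ S ⁺ v → u ≡ v ⊎ u ∈ S
∈⁺⇒≡∨∈ {v = v} {u} {S} u∈ with u ≟ v
... | yes u≡v = inj₁ u≡v
... | no  u≢v = inj₂ (lookup⇒[]= u S (≡.trans (≡.sym (lookup∘updateAt′ u v u≢v S)) ([]=⇒lookup u∈)))

∈⇒∈⁺ : {v u : Fin n} {S : Subset n} → u ∈ S → u ∈ S ⁺ v
∈⇒∈⁺ {v = v} {u} {S} u∈S with u ≟ v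
... | yes ≡.refl = v∈S⁺v v S
... | no  u≢v    = updateAt-minimal u v S u≢v u∈S

∈⁻⇒≢ : {v u : Fin n} {S : Subset n} → u ∈ S ⁻ v → u ≢ v
∈⁻⇒≢ {S = S} u∈ ≡.refl = v∉S⁻v _ S u∈

∈⁻⇒∈ : {v u : Fin n} {S : Subset n} → u ∈ S ⁻ v → u ∈ S
∈⁻⇒∈ {v = v} {u} {S} u∈ =
  lookup⇒[]= u S (≡.trans (≡.sym (lookup∘updateAt′ u v (∈⁻⇒≢ u∈) S)) ([]=⇒lookup u∈))

∈⇒∈⁻ : {v u : Fin n} {S : Subset n} → u ∈ S → u ≢ v → u ∈ S ⁻ v
∈⇒∈⁻ {v = v} {u} {S} u∈S u≢v = updateAt-minimal u v S u≢v u∈S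

⊆⇒⊆⁻ : {v : Fin n} {S T : Subset n} → S ⊆ T → v ∉ S → S ⊆ T ⁻ v
⊆⇒⊆⁻ S⊆T v∉S u∈S = ∈⇒∈⁻ (S⊆T u∈S) λ { ≡.refl → v∉S u∈S }

⁺⁻-cancel : {v : Fin n} {S : Subset n} → v ∉ S → S ⁺ v ⁻ v ≡ S
⁺⁻-cancel {v = zero}  {inside  ∷ S} v∉S = ⊥-elim (v∉S here)
⁺⁻-cancel {v = zero}  {outside ∷ S} v∉S = ≡.refl
⁺⁻-cancel {v = suc v} {s ∷ S}       v∉S = ≡.cong (s ∷_) (⁺⁻-cancel (v∉S ∘ there))

⁻⁺-cancel : {v : Fin n} {S : Subset n} → v ∈ S → S ⁻ v ⁺ v ≡ S
⁻⁺-cancel here        = ≡.refl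
⁻⁺-cancel (there v∈S) = ≡.cong (_ ∷_) (⁻⁺-cancel v∈S)

∣⁺∣ : {v : Fin n} {S : Subset n} → v ∉ S → ∣ S ⁺ v ∣ ≡ suc ∣ S ∣
∣⁺∣ {v = zero}  {inside  ∷ S} v∉S = ⊥-elim (v∉S here)
∣⁺∣ {v = zero}  {outside ∷ S} v∉S = ≡.refl
∣⁺∣ {v = suc v} {inside  ∷ S} v∉S = ≡.cong suc (∣⁺∣ (v∉S ∘ there))
∣⁺∣ {v = suc v} {outside ∷ S} v∉S = ∣⁺∣ (v∉S ∘ there)

∣⁻∣ : {v : Fin n} {S : Subset n} → v ∈ S → ∣ S ∣ ≡ suc ∣ S ⁻ v ∣
∣⁻∣ here                            = ≡.refl
∣⁻∣ {S = inside  ∷ S} (there v∈S) = ≡.cong suc (∣⁻∣ v∈S)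
∣⁻∣ {S = outside ∷ S} (there v∈S) = ∣⁻∣ v∈S

-- The graph deletion `_∖_` is built on the library's `_-_`, here `_∸ˢ_`, while the proof deletes
-- with `_⁻_`; together with `V∖≡V⁻` this passes from one to the other.
v∉S-v : (v : Fin n) (S : Subset n) → v ∉ S ∸ˢ v
v∉S-v zero    (s ∷ S) ()
v∉S-v (suc v) (s ∷ S) (there v∈) = v∉S-v v S v∈

-- Independent sets and links

module _ (Γ : Graph n) where
  open Graph Γ using (_~_; _~?_; ~-irrefl)

  ~⇒∈N : ∀ {u v} → v ~ u → u ∈ N Γ v
  ~⇒∈N {u} {v} v~u = lookup⇒[]= u _ (≡.trans (lookup∘tabulate _ u) (dec-true (v ~? u) v~u))

  ∈N⇒~ : ∀ {u v} → u ∈ N Γ v → v ~ u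
  ∈N⇒~ {u} {v} u∈N with v ~? u | ≡.trans (≡.sym (lookup∘tabulate _ u)) ([]=⇒lookup u∈N)
  ... | yes v~u | _  = v~u
  ... | no  _   | ()

  ∈V∖ : ∀ {u v} → u ∈ V Γ → u ≢ v → u ∈ V (Γ ∖ v)
  ∈V∖ u∈V u≢v = x∈p∩q⁺ (u∈V , x∈p∧x≢y⇒x∈p-y u∈V u≢v)

  ∈V∖⇒∈V : ∀ {u v} → u ∈ V (Γ ∖ v) → u ∈ V Γ
  ∈V∖⇒∈V u∈ = proj₁ (x∈p∩q⁻ (V Γ) _ u∈)

  ∈V∖⇒≢ : ∀ {u v} → u ∈ V (Γ ∖ v) → u ≢ v
  ∈V∖⇒≢ {u} u∈ ≡.refl = v∉S-v u (V Γ) (proj₂ (x∈p∩q⁻ (V Γ) _ u∈))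

  V∖≡V⁻ : ∀ {v} → V (Γ ∖ v) ≡ V Γ ⁻ v
  V∖≡V⁻ = ⊆-antisym (λ u∈ → ∈⇒∈⁻ (∈V∖⇒∈V u∈) (∈V∖⇒≢ u∈)) (λ u∈ → ∈V∖ (∈⁻⇒∈ u∈) (∈⁻⇒≢ u∈))

  opaque
    -- The part of `S` outside the closed neighbourhood of `v`. Its independence complex is the link
    -- of `v` in that of `S ⁺ v`, if `v` is a vertex of `Γ`.
    lk : Subset n → Fin n → Subset n
    lk S v = (S ∩ ∁ (N Γ v)) ⁻ v

    ∈lk : ∀ {S u v} → u ∈ S → u ≢ v → ¬ (v ~ u) → u ∈ lk S v
    ∈lk u∈S u≢v v≁u = ∈⇒∈⁻ (x∈p∩q⁺ (u∈S , x∉p⇒x∈∁p (v≁u ∘ ∈N⇒~))) u≢v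

    lk-≢ : ∀ {S u v} → u ∈ lk S v → u ≢ v
    lk-≢ u∈lk = ∈⁻⇒≢ u∈lk

    lk⊆ : ∀ {S u v} → u ∈ lk S v → u ∈ S
    lk⊆ {S} {u} {v} u∈lk = proj₁ (x∈p∩q⁻ S (∁ (N Γ v)) (∈⁻⇒∈ u∈lk))

    lk-≁ : ∀ {S u v} → u ∈ lk S v → ¬ (v ~ u)
    lk-≁ {S} {u} {v} u∈lk v~u = x∈∁p⇒x∉p (proj₂ (x∈p∩q⁻ S (∁ (N Γ v)) (∈⁻⇒∈ u∈lk))) (~⇒∈N v~u)

  -- The faces of `Ind (Γ [ S ])`, with independence measured in `Γ` itself, so that only `⊆S`
  -- changes when a face is moved to another vertex set.
  record Face (S σ : Subset n) : Set where
    constructor face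
    field
      ⊆V          : ∀ {u} → u ∈ σ → u ∈ V Γ
      ⊆S          : ∀ {u} → u ∈ σ → u ∈ S
      independent : ∀ {u v} → u ∈ σ → v ∈ σ → ¬ (u ~ v)

open Face

-- Independent sets of the Lozin transform

pattern none σ  = outside ∷ outside ∷ outside ∷ outside ∷ σ
pattern 𝕪∪ σ    = inside  ∷ outside ∷ outside ∷ outside ∷ σ
pattern 𝕒∪ σ    = outside ∷ inside  ∷ outside ∷ outside ∷ σ
pattern 𝕓∪ σ    = outside ∷ outside ∷ inside  ∷ outside ∷ σ
pattern 𝕫∪ σ    = outside ∷ outside ∷ outside ∷ inside  ∷ σ
pattern 𝕪𝕓∪ σ   = inside  ∷ outside ∷ inside  ∷ outside ∷ σ
pattern 𝕪𝕫∪ σ   = inside  ∷ outside ∷ outside ∷ inside  ∷ σ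
pattern 𝕒𝕫∪ σ   = outside ∷ inside  ∷ outside ∷ inside  ∷ σ
pattern full σ  = inside  ∷ inside  ∷ inside  ∷ inside  ∷ σ

-- The sets below contain two consecutive vertices of the path 𝕪𝕒𝕓𝕫; together
-- with the eight independent sets above they exhaust all cases.
pattern 𝕪𝕒 s t σ = inside  ∷ inside  ∷ s       ∷ t      ∷ σ
pattern 𝕒𝕓 t σ   = outside ∷ inside  ∷ inside  ∷ t      ∷ σ
pattern 𝕪𝕓𝕫 σ    = inside  ∷ outside ∷ inside  ∷ inside ∷ σ
pattern 𝕓𝕫 σ     = outside ∷ outside ∷ inside  ∷ inside ∷ σ

pattern lift p = there (there (there (there p)))

module LozinGraph (G : Graph n) (x : Fin n) (x∈V : x ∈ V G)
                  (Y Z : Subset n) (N≡Y∪Z : N G x ≡ Y ∪ Z) where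
  open Graph G using (_~_; ~-irrefl; ~⇒∈V; ~-sym)

  L : Graph (suc (suc (suc (suc n))))
  L = Lozin G x Y Z N≡Y∪Z

  open Graph L using () renaming (_~_ to _~ᴸ_)

  ~⇒∈Y∪Z : ∀ {u} → x ~ u → u ∈ Y ⊎ u ∈ Z
  ~⇒∈Y∪Z x~u = x∈p∪q⁻ Y Z (≡.subst (_ ∈_) N≡Y∪Z (~⇒∈N G x~u))

  ∈Y⇒~ : ∀ {u} → u ∈ Y → x ~ u
  ∈Y⇒~ u∈Y = ∈N⇒~ G (≡.subst (_ ∈_) (≡.sym N≡Y∪Z) (x∈p∪q⁺ (inj₁ u∈Y)))

  ∈Z⇒~ : ∀ {u} → u ∈ Z → x ~ u
  ∈Z⇒~ u∈Z = ∈N⇒~ G (≡.subst (_ ∈_) (≡.sym N≡Y∪Z) (x∈p∪q⁺ (inj₂ u∈Z)))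

  old~old : ∀ {u v} → u ∈ V (G ∖ x) → v ∈ V (G ∖ x) → u ~ v → old u ~ᴸ old v
  old~old u∈ v∈ u~v = fwd (G∖x (u~v , proj₂ (x∈p∩q⁻ (V G) _ u∈) , proj₂ (x∈p∩q⁻ (V G) _ v∈)))

  face-old : ∀ {s₀ s₁ s₂ s₃ t₀ t₁ t₂ t₃ S σ} →
             Face L (s₀ ∷ s₁ ∷ s₂ ∷ s₃ ∷ S) (t₀ ∷ t₁ ∷ t₂ ∷ t₃ ∷ σ) → Face G S σ
  face-old F = face (∈V∖⇒∈V G ∘ inV) (λ u∈σ → drop (⊆S F (lift u∈σ)))
                    (λ u∈σ v∈σ u~v → independent F (lift u∈σ) (lift v∈σ) (old~old (inV u∈σ) (inV v∈σ) u~v))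
    where
    drop : ∀ {u s₀ s₁ s₂ s₃} {S : Subset n} → old u ∈ s₀ ∷ s₁ ∷ s₂ ∷ s₃ ∷ S → u ∈ S
    drop (lift p) = p

    inV : ∀ {u} → u ∈ _ → u ∈ V (G ∖ x)
    inV u∈σ = drop (⊆V F (lift u∈σ))

  face-∩ : ∀ {S W σ} → Face G S σ → (∀ {u} → u ∈ σ → u ∉ W) → Face G (S ∩ ∁ W) σ
  face-∩ F ∉W = face (⊆V F) (λ u∈σ → x∈p∩q⁺ (⊆S F u∈σ , x∉p⇒x∈∁p (∉W u∈σ))) (independent F)

  face-∉Y : ∀ {T t₁ t₂ t₃ σ} → Face L T (inside ∷ t₁ ∷ t₂ ∷ t₃ ∷ σ) → ∀ {u} → u ∈ σ → u ∉ Y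
  face-∉Y F u∈σ u∈Y = independent F here (lift u∈σ) (fwd (yY u∈Y))

  face-∉Z : ∀ {T t₀ t₁ t₂ σ} → Face L T (t₀ ∷ t₁ ∷ t₂ ∷ inside ∷ σ) → ∀ {u} → u ∈ σ → u ∉ Z
  face-∉Z F u∈σ u∈Z = independent F (there (there (there here))) (lift u∈σ) (fwd (zZ u∈Z))

  ∌𝕪𝕒 : ∀ {T s t σ} → ¬ Face L T (𝕪𝕒 s t σ)
  ∌𝕪𝕒 F = independent F here (there here) (fwd ya)

  ∌𝕒𝕓 : ∀ {T t₀ t₃ σ} → ¬ Face L T (t₀ ∷ inside ∷ inside ∷ t₃ ∷ σ)
  ∌𝕒𝕓 F = independent F (there here) (there (there here)) (fwd ab)

  ∌𝕓𝕫 : ∀ {T t₀ t₁ σ} → ¬ Face L T (t₀ ∷ t₁ ∷ inside ∷ inside ∷ σ)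
  ∌𝕓𝕫 F = independent F (there (there here)) (there (there (there here))) (fwd bz)

  data PathIndependent : (t₀ t₁ t₂ t₃ : Side) → Set where
    ind-∅  : PathIndependent outside outside outside outside
    ind-y  : PathIndependent inside  outside outside outside
    ind-a  : PathIndependent outside inside  outside outside
    ind-b  : PathIndependent outside outside inside  outside
    ind-z  : PathIndependent outside outside outside inside
    ind-yb : PathIndependent inside  outside inside  outside
    ind-yz : PathIndependent inside  outside outside inside
    ind-az : PathIndependent outside inside  outside inside

  path-independent : ∀ {t₀ t₁ t₂ t₃ S σ} → PathIndependent t₀ t₁ t₂ t₃ →
                     (t₀ ≡ inside → ∀ {u} → u ∈ σ → u ∉ Y) →
                     (t₃ ≡ inside → ∀ {u} → u ∈ σ → u ∉ Z) →
                     Face G S σ → ∀ {u v} → u ∈ t₀ ∷ t₁ ∷ t₂ ∷ t₃ ∷ σ → v ∈ t₀ ∷ t₁ ∷ t₂ ∷ t₃ ∷ σ →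
                     ¬ LozinEdge G x Y Z u v
  -- A path edge needs two consecutive sides `inside`, which no constructor of `PathIndependent`
  -- has.
  path-independent () ∉Y ∉Z F here                 (there here)                 ya
  path-independent () ∉Y ∉Z F (there here)         (there (there here))         ab
  path-independent () ∉Y ∉Z F (there (there here)) (there (there (there here))) bz
  path-independent _ ∉Y ∉Z F here (lift v∈σ) (yY v∈Y) = ∉Y ≡.refl v∈σ v∈Y
  path-independent _ ∉Y ∉Z F (there (there (there here))) (lift v∈σ) (zZ v∈Z) = ∉Z ≡.refl v∈σ v∈Z
  path-independent _ ∉Y ∉Z F (lift u∈σ) (lift v∈σ) (G∖x (u~v , _)) = independent F u∈σ v∈σ u~v

  -- Every edge of ℒ(G) lies in the path, joins `𝕪` to `Y` or `𝕫` to `Z`, or comes from G - x; the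
  -- hypotheses exclude these kinds one by one. That `x ∉ S` places `σ` in G - x.
  face-new : ∀ {t₀ t₁ t₂ t₃ S T σ} → x ∉ S → PathIndependent t₀ t₁ t₂ t₃ →
             t₀ ∷ t₁ ∷ t₂ ∷ t₃ ∷ σ ⊆ T →
             (t₀ ≡ inside → ∀ {u} → u ∈ σ → u ∉ Y) →
             (t₃ ≡ inside → ∀ {u} → u ∈ σ → u ∉ Z) →
             Face G S σ → Face L T (t₀ ∷ t₁ ∷ t₂ ∷ t₃ ∷ σ)
  face-new {t₀} {t₁} {t₂} {t₃} {S} {T} {σ} x∉S ind t∷σ⊆T ∉Y ∉Z F = face inV t∷σ⊆T λ
    { u∈ v∈ (fwd e) → path-independent ind ∉Y ∉Z F u∈ v∈ e
    ; u∈ v∈ (bwd e) → path-independent ind ∉Y ∉Z F v∈ u∈ e }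
    where
    inV : t₀ ∷ t₁ ∷ t₂ ∷ t₃ ∷ σ ⊆ V L
    inV here                         = here
    inV (there here)                 = there here
    inV (there (there here))         = there (there here)
    inV (there (there (there here))) = there (there (there here))
    inV (lift u∈σ)                   = lift (∈V∖ G (⊆V F u∈σ) λ { ≡.refl → x∉S (⊆S F u∈σ) })

  ⊆full : ∀ {t₀ t₁ t₂ t₃} {σ S : Subset n} → σ ⊆ S → t₀ ∷ t₁ ∷ t₂ ∷ t₃ ∷ σ ⊆ full S
  ⊆full σ⊆S here                         = here
  ⊆full σ⊆S (there here)                 = there here
  ⊆full σ⊆S (there (there here))         = there (there here)
  ⊆full σ⊆S (there (there (there here))) = there (there (there here))
  ⊆full σ⊆S (lift u∈σ)                   = lift (σ⊆S u∈σ)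

  face-none : ∀ {S σ} → x ∉ S → Face G S σ → Face L (none S) (none σ)
  face-none x∉S F = face-new x∉S ind-∅ (λ { (lift u∈σ) → lift (⊆S F u∈σ) }) (λ ()) (λ ()) F

  connected : Connected G → Connected L
  connected (_ , path) = (𝕪 , here) , λ u∈ v∈ → to-𝕪 u∈ ◅◅ reverse (Graph.~-sym L) (to-𝕪 v∈)
    where
    𝕒-to-𝕪 : Star _~ᴸ_ 𝕒 𝕪
    𝕒-to-𝕪 = bwd ya ◅ ε

    𝕫-to-𝕪 : Star _~ᴸ_ 𝕫 𝕪
    𝕫-to-𝕪 = bwd bz ◅ bwd ab ◅ 𝕒-to-𝕪

    -- The walk to `x` is followed until its next step enters `x`. The vertex reached by then lies
    -- in `Y` or in `Z`, and the path `𝕪𝕒𝕓𝕫` leads on to `𝕪`.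
    old-to-𝕪 : ∀ {u} → u ∈ V (G ∖ x) → Star _~_ u x → Star _~ᴸ_ (old u) 𝕪
    old-to-𝕪 u∈ ε = ⊥-elim (∈V∖⇒≢ G u∈ ≡.refl)
    old-to-𝕪 u∈ (_◅_ {j = v} u~v v⋯x) with v ≟ x
    ... | no v≢x = old~old u∈ v∈ u~v ◅ old-to-𝕪 v∈ v⋯x
      where v∈ = ∈V∖ G (~⇒∈V (~-sym u~v)) v≢x
    ... | yes ≡.refl with ~⇒∈Y∪Z (~-sym u~v)
    ...   | inj₁ u∈Y = bwd (yY u∈Y) ◅ ε
    ...   | inj₂ u∈Z = bwd (zZ u∈Z) ◅ 𝕫-to-𝕪

    to-𝕪 : ∀ {u} → u ∈ V L → Star _~ᴸ_ u 𝕪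
    to-𝕪 here                         = ε
    to-𝕪 (there here)                 = 𝕒-to-𝕪
    to-𝕪 (there (there here))         = bwd ab ◅ 𝕒-to-𝕪
    to-𝕪 (there (there (there here))) = 𝕫-to-𝕪
    to-𝕪 (lift u∈)                    = old-to-𝕪 u∈ (path (∈V∖⇒∈V G u∈) x∈V)

module Homology {c ℓ} (𝕜 : Field c ℓ) where
  open Field 𝕜 hiding (zero) renaming (Carrier to K)
  open Sum +-commutativeMonoid using (sum)
  open SemiringExp semiring using (_^_)
  open RingProperties ring
    using (-‿+-comm; -0#≈0#; x+x≈x⇒x≈0; -1*x≈-x; +-inverseʳ-unique; +-cancelʳ)
  open SetoidReasoning setoid

  -- A solver for identities in abelian groups

  module AbelianGroupSolver where
    open Mult +-monoid using (×-homo-+) renaming (_×_ to _·_)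

    infixl 6 _⊕_ _⊝_
    infix  8 ⊝_

    data Expr (n : ℕ) : Set where
      var : Fin n → Expr n
      ∅₀  : Expr n
      _⊕_ : Expr n → Expr n → Expr n
      ⊝_  : Expr n → Expr n

    _⊝_ : Expr n → Expr n → Expr n
    e ⊝ e′ = e ⊕ ⊝ e′

    ⟦_⟧ : Expr n → Vec K n → K
    ⟦ var i ⟧  ρ = lookup ρ i
    ⟦ ∅₀ ⟧     ρ = 0#
    ⟦ e ⊕ e′ ⟧ ρ = ⟦ e ⟧ ρ + ⟦ e′ ⟧ ρ
    ⟦ ⊝ e ⟧    ρ = - ⟦ e ⟧ ρ

    unit : Fin n → Vec ℕ n
    unit i = replicate _ 0 [ i ]≔ 1

    _⊞_ : Vec ℕ n → Vec ℕ n → Vec ℕ n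
    _⊞_ = zipWith ℕ._+_

    -- Multiplicities of the variables when the expression is written as a difference of two sums;
    -- two vectors of naturals stand in for one of integers.
    positive negative : Expr n → Vec ℕ n
    positive (var i)  = unit i
    positive ∅₀       = replicate _ 0
    positive (e ⊕ e′) = positive e ⊞ positive e′
    positive (⊝ e)    = negative e
    negative (var i)  = replicate _ 0
    negative ∅₀       = replicate _ 0
    negative (e ⊕ e′) = negative e ⊞ negative e′
    negative (⊝ e)    = positive e

    combine : Vec ℕ n → Vec K n → K
    combine []       []      = 0#
    combine (k ∷ ks) (a ∷ ρ) = k · a + combine ks ρ

    interchange : ∀ a b c d → (a + b) + (c + d) ≈ (a + c) + (b + d)
    interchange a b c d = begin
      (a + b) + (c + d) ≈⟨ +-assoc a b (c + d) ⟩
      a + (b + (c + d)) ≈⟨ +-congˡ (+-assoc b c d) ⟨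
      a + ((b + c) + d) ≈⟨ +-congˡ (+-congʳ (+-comm b c)) ⟩
      a + ((c + b) + d) ≈⟨ +-congˡ (+-assoc c b d) ⟩
      a + (c + (b + d)) ≈⟨ +-assoc a c (b + d) ⟨
      (a + c) + (b + d) ∎

    combine-0 : (ρ : Vec K n) → combine (replicate n 0) ρ ≈ 0#
    combine-0 []      = refl
    combine-0 (a ∷ ρ) = trans (+-identityˡ _) (combine-0 ρ)

    combine-unit : (i : Fin n) (ρ : Vec K n) → combine (unit i) ρ ≈ lookup ρ i
    combine-unit zero    (a ∷ ρ) = trans (+-cong (+-identityʳ a) (combine-0 ρ)) (+-identityʳ a)
    combine-unit (suc i) (a ∷ ρ) = trans (+-identityˡ _) (combine-unit i ρ)

    combine-⊞ : (ks ls : Vec ℕ n) (ρ : Vec K n) → combine (ks ⊞ ls) ρ ≈ combine ks ρ + combine ls ρ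
    combine-⊞ []       []       []      = sym (+-identityʳ 0#)
    combine-⊞ (k ∷ ks) (l ∷ ls) (a ∷ ρ) =
      trans (+-cong (×-homo-+ a k l) (combine-⊞ ks ls ρ)) (interchange _ _ _ _)

    normal : (e : Expr n) (ρ : Vec K n) → ⟦ e ⟧ ρ + combine (negative e) ρ ≈ combine (positive e) ρ
    normal (var i) ρ = trans (+-cong (sym (combine-unit i ρ)) (combine-0 ρ)) (+-identityʳ _)
    normal ∅₀      ρ = +-identityˡ _
    normal (e ⊕ e′) ρ = begin
      (⟦ e ⟧ ρ + ⟦ e′ ⟧ ρ) + combine (negative e ⊞ negative e′) ρ
        ≈⟨ +-congˡ (combine-⊞ (negative e) (negative e′) ρ) ⟩
      (⟦ e ⟧ ρ + ⟦ e′ ⟧ ρ) + (combine (negative e) ρ + combine (negative e′) ρ)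
        ≈⟨ interchange _ _ _ _ ⟩
      (⟦ e ⟧ ρ + combine (negative e) ρ) + (⟦ e′ ⟧ ρ + combine (negative e′) ρ)
        ≈⟨ +-cong (normal e ρ) (normal e′ ρ) ⟩
      combine (positive e) ρ + combine (positive e′) ρ
        ≈⟨ combine-⊞ (positive e) (positive e′) ρ ⟨
      combine (positive e ⊞ positive e′) ρ ∎
    normal (⊝ e) ρ = begin
      - ⟦ e ⟧ ρ + combine (positive e) ρ               ≈⟨ +-congˡ (normal e ρ) ⟨
      - ⟦ e ⟧ ρ + (⟦ e ⟧ ρ + combine (negative e) ρ)   ≈⟨ +-assoc _ _ _ ⟨
      (- ⟦ e ⟧ ρ + ⟦ e ⟧ ρ) + combine (negative e) ρ   ≈⟨ +-congʳ (-‿inverseˡ _) ⟩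
      0# + combine (negative e) ρ                      ≈⟨ +-identityˡ _ ⟩
      combine (negative e) ρ                           ∎

    -- Adding both negative parts to both sides leaves sums with natural coefficients, and the added
    -- terms cancel. For concrete expressions the premise on coefficients is `≡.refl`.
    solve : (ρ : Vec K n) (e e′ : Expr n) →
            positive e ⊞ negative e′ ≡ positive e′ ⊞ negative e → ⟦ e ⟧ ρ ≈ ⟦ e′ ⟧ ρ
    solve ρ e e′ eq = +-cancelʳ (combine (negative e) ρ + combine (negative e′) ρ) _ _ (begin
      ⟦ e ⟧ ρ + (combine (negative e) ρ + combine (negative e′) ρ)   ≈⟨ +-assoc _ _ _ ⟨
      (⟦ e ⟧ ρ + combine (negative e) ρ) + combine (negative e′) ρ   ≈⟨ +-congʳ (normal e ρ) ⟩
      combine (positive e) ρ + combine (negative e′) ρ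
        ≈⟨ combine-⊞ (positive e) (negative e′) ρ ⟨
      combine (positive e ⊞ negative e′) ρ                           ≡⟨ ≡.cong (λ ks → combine ks ρ) eq ⟩
      combine (positive e′ ⊞ negative e) ρ
        ≈⟨ combine-⊞ (positive e′) (negative e) ρ ⟩
      combine (positive e′) ρ + combine (negative e) ρ               ≈⟨ +-congʳ (normal e′ ρ) ⟨
      (⟦ e′ ⟧ ρ + combine (negative e′) ρ) + combine (negative e) ρ  ≈⟨ +-assoc _ _ _ ⟩
      ⟦ e′ ⟧ ρ + (combine (negative e′) ρ + combine (negative e) ρ)  ≈⟨ +-congˡ (+-comm _ _) ⟩
      ⟦ e′ ⟧ ρ + (combine (negative e) ρ + combine (negative e′) ρ)  ∎)

    pattern v₀ = var 0F
    pattern v₁ = var 1F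
    pattern v₂ = var 2F
    pattern v₃ = var 3F
    pattern v₄ = var 4F
    pattern v₅ = var 5F

  open AbelianGroupSolver using (solve; ∅₀; _⊕_; ⊝_; _⊝_; v₀; v₁; v₂; v₃; v₄; v₅)

  Chain : ℕ → Set c
  Chain n = Subset n → K

  infix  4 _≋_
  infixl 6 _∔_ _∸_
  infix  8 ∸_

  _≋_ : Chain n → Chain n → Set ℓ
  f ≋ g = ∀ σ → f σ ≈ g σ

  0̇ : Chain n
  0̇ _ = 0#

  _∔_ _∸_ : Chain n → Chain n → Chain n
  (f ∔ g) σ = f σ + g σ
  (f ∸ g) σ = f σ - g σ

  ∸_ : Chain n → Chain n
  (∸ f) σ = - f σ

  -- Additive operators

  -- Chains are compared pointwise up to `_≈_`, so congruence has to be a field; zero and negatives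
  -- are then preserved by additivity.
  record Additive (F : Chain m → Chain n) : Set (c ⊔ ℓ) where
    field
      cong   : ∀ {f g} → f ≋ g → F f ≋ F g
      homo-+ : ∀ f g → F (f ∔ g) ≋ F f ∔ F g

    vanishes : ∀ {f} → f ≋ 0̇ → F f ≋ 0̇
    vanishes {f} f≋0 τ = x+x≈x⇒x≈0 (F f τ) (begin
      F f τ + F f τ ≈⟨ homo-+ f f τ ⟨
      F (f ∔ f) τ   ≈⟨ cong (λ σ → trans (+-congʳ (f≋0 σ)) (+-identityˡ (f σ))) τ ⟩
      F f τ         ∎)

    homo-neg : ∀ f → F (∸ f) ≋ ∸ F f
    homo-neg f τ = +-inverseʳ-unique (F f τ) (F (∸ f) τ) (begin
      F f τ + F (∸ f) τ ≈⟨ homo-+ f (∸ f) τ ⟨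
      F (f ∸ f) τ       ≈⟨ vanishes (λ σ → -‿inverseʳ (f σ)) τ ⟩
      0#                ∎)

    homo-− : ∀ f g → F (f ∸ g) ≋ F f ∸ F g
    homo-− f g τ = trans (homo-+ f (∸ g) τ) (+-congˡ (homo-neg g τ))

  open Additive

  -- The boundary operator, one vertex at a time

  opaque
    -- Opaque, so that outside this block boundaries are computed only by the recursion `∂-[]`,
    -- `∂-out`, `∂-in` on the first vertex; `∂ᴷ≡∂` leads back to the sum over all vertices.
    ∂ᴷ : Chain n → Chain n
    ∂ᴷ = ∂ 𝕜

    ∂ᴷ≡∂ : (f : Chain n) (τ : Subset n) → ∂ᴷ f τ ≡ ∂ 𝕜 f τ
    ∂ᴷ≡∂ f τ = ≡.refl

    ∂-[] : (f : Chain 0) → ∂ᴷ f [] ≈ 0#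
    ∂-[] f = refl

    -- Vertex zero can be inserted, in first position and with sign one. It is absent from the face,
    -- so the signs of the other vertices stay as they are.
    ∂-out : (f : Chain (suc n)) (τ : Subset n) →
            ∂ᴷ f (outside ∷ τ) ≈ f (inside ∷ τ) + ∂ᴷ (f ∘ (outside ∷_)) τ
    ∂-out f τ = +-congʳ (begin
      (- 1#) ^ ∣ τ ∩ tabulate (λ _ → false) ∣ * f (inside ∷ (τ ∪ ∅))
        ≡⟨ ≡.cong₂ (λ k ρ → (- 1#) ^ k * f (inside ∷ ρ)) (∩-none τ) (∪-identityʳ τ) ⟩
      1# * f (inside ∷ τ) ≈⟨ *-identityˡ _ ⟩
      f (inside ∷ τ)      ∎)

    -- Vertex zero is present and precedes every inserted vertex, which shifts all positions by one
    -- and flips all signs.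
    ∂-in : ∀ {n} (f : Chain (suc n)) (τ : Subset n) →
           ∂ᴷ f (inside ∷ τ) ≈ - ∂ᴷ (f ∘ (inside ∷_)) τ
    ∂-in {n} f τ = begin
      0# + sum s ≈⟨ +-identityˡ _ ⟩
      sum s      ≈⟨ sum-neg s t term ⟩
      - sum t    ∎
      where
      sign : Fin n → K
      sign v = (- 1#) ^ ∣ τ ∩ below v ∣

      t s : Fin n → K
      t v = if does (v ∈? τ) then 0# else sign v * f (inside ∷ (τ ∪ ⁅ v ⁆))
      s v = if does (v ∈? τ) then 0# else (- 1# * sign v) * f (inside ∷ (τ ∪ ⁅ v ⁆))

      term : ∀ v → s v ≈ - t v
      term v with does (v ∈? τ)
      ... | true  = sym -0#≈0#
      ... | false = trans (*-assoc _ _ _) (-1*x≈-x _)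

      sum-neg : ∀ {k} (s t : Fin k → K) → (∀ v → s v ≈ - t v) → sum s ≈ - sum t
      sum-neg {zero}  s t s≈-t = sym -0#≈0#
      sum-neg {suc k} s t s≈-t =
        trans (+-cong (s≈-t zero) (sum-neg (s ∘ suc) (t ∘ suc) (s≈-t ∘ suc))) (-‿+-comm _ _)

  ∂-additive : Additive (∂ᴷ {n})
  ∂-additive .cong {f} {g} f≋g []            = trans (∂-[] f) (sym (∂-[] g))
  ∂-additive .cong {f} {g} f≋g (outside ∷ τ) = begin
    ∂ᴷ f (outside ∷ τ)                        ≈⟨ ∂-out f τ ⟩
    f (inside ∷ τ) + ∂ᴷ (f ∘ (outside ∷_)) τ  ≈⟨ +-cong (f≋g _) (∂-additive .cong (λ σ → f≋g _) τ) ⟩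
    g (inside ∷ τ) + ∂ᴷ (g ∘ (outside ∷_)) τ  ≈⟨ ∂-out g τ ⟨
    ∂ᴷ g (outside ∷ τ)                        ∎
  ∂-additive .cong {f} {g} f≋g (inside ∷ τ) = begin
    ∂ᴷ f (inside ∷ τ)          ≈⟨ ∂-in f τ ⟩
    - ∂ᴷ (f ∘ (inside ∷_)) τ   ≈⟨ -‿cong (∂-additive .cong (λ σ → f≋g _) τ) ⟩
    - ∂ᴷ (g ∘ (inside ∷_)) τ   ≈⟨ ∂-in g τ ⟨
    ∂ᴷ g (inside ∷ τ)          ∎
  ∂-additive .homo-+ f g []            =
    trans (∂-[] _) (trans (sym (+-identityʳ 0#)) (sym (+-cong (∂-[] f) (∂-[] g))))
  ∂-additive .homo-+ f g (outside ∷ τ) = begin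
    ∂ᴷ (f ∔ g) (outside ∷ τ)
      ≈⟨ ∂-out (f ∔ g) τ ⟩
    f (inside ∷ τ) + g (inside ∷ τ) + ∂ᴷ (λ σ → f (outside ∷ σ) + g (outside ∷ σ)) τ
      ≈⟨ +-congˡ (∂-additive .homo-+ _ _ τ) ⟩
    f (inside ∷ τ) + g (inside ∷ τ) + (∂ᴷ (f ∘ (outside ∷_)) τ + ∂ᴷ (g ∘ (outside ∷_)) τ)
      ≈⟨ solve (f (inside ∷ τ) ∷ g (inside ∷ τ) ∷ ∂ᴷ (f ∘ (outside ∷_)) τ ∷ ∂ᴷ (g ∘ (outside ∷_)) τ ∷ [])
           (v₀ ⊕ v₁ ⊕ (v₂ ⊕ v₃)) ((v₀ ⊕ v₂) ⊕ (v₁ ⊕ v₃)) ≡.refl ⟩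
    (f (inside ∷ τ) + ∂ᴷ (f ∘ (outside ∷_)) τ) + (g (inside ∷ τ) + ∂ᴷ (g ∘ (outside ∷_)) τ)
      ≈⟨ +-cong (∂-out f τ) (∂-out g τ) ⟨
    ∂ᴷ f (outside ∷ τ) + ∂ᴷ g (outside ∷ τ) ∎
  ∂-additive .homo-+ f g (inside ∷ τ) = begin
    ∂ᴷ (f ∔ g) (inside ∷ τ)                                   ≈⟨ ∂-in (f ∔ g) τ ⟩
    - ∂ᴷ (λ σ → f (inside ∷ σ) + g (inside ∷ σ)) τ            ≈⟨ -‿cong (∂-additive .homo-+ _ _ τ) ⟩
    - (∂ᴷ (f ∘ (inside ∷_)) τ + ∂ᴷ (g ∘ (inside ∷_)) τ)       ≈⟨ -‿+-comm _ _ ⟨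
    - ∂ᴷ (f ∘ (inside ∷_)) τ - ∂ᴷ (g ∘ (inside ∷_)) τ         ≈⟨ +-cong (∂-in f τ) (∂-in g τ) ⟨
    ∂ᴷ f (inside ∷ τ) + ∂ᴷ g (inside ∷ τ)                     ∎

  -- Join with and contraction by a vertex

  cone D : Fin n → Chain n → Chain n

  cone zero    f (outside ∷ σ) = 0#
  cone zero    f (inside ∷ σ)  = f (outside ∷ σ)
  cone (suc v) f (outside ∷ σ) = cone v (f ∘ (outside ∷_)) σ
  -- Every vertex of the face below `v` contributes a sign, as in left exterior multiplication by
  -- `v`; `D` has the signs of the dual contraction.
  cone (suc v) f (inside ∷ σ)  = - cone v (f ∘ (inside ∷_)) σ

  D zero    f (outside ∷ σ) = f (inside ∷ σ)
  D zero    f (inside ∷ σ)  = 0#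
  D (suc v) f (outside ∷ σ) = D v (f ∘ (outside ∷_)) σ
  D (suc v) f (inside ∷ σ)  = - D v (f ∘ (inside ∷_)) σ

  cone-additive : (v : Fin n) → Additive (cone v)
  cone-additive zero    .cong f≋g (outside ∷ σ) = refl
  cone-additive zero    .cong f≋g (inside ∷ σ)  = f≋g _
  cone-additive (suc v) .cong f≋g (outside ∷ σ) = cone-additive v .cong (λ _ → f≋g _) σ
  cone-additive (suc v) .cong f≋g (inside ∷ σ)  = -‿cong (cone-additive v .cong (λ _ → f≋g _) σ)
  cone-additive zero    .homo-+ f g (outside ∷ σ) = sym (+-identityʳ 0#)
  cone-additive zero    .homo-+ f g (inside ∷ σ)  = refl
  cone-additive (suc v) .homo-+ f g (outside ∷ σ) = cone-additive v .homo-+ _ _ σ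
  cone-additive (suc v) .homo-+ f g (inside ∷ σ)  =
    trans (-‿cong (cone-additive v .homo-+ _ _ σ)) (sym (-‿+-comm _ _))

  D-additive : (v : Fin n) → Additive (D v)
  D-additive zero    .cong f≋g (outside ∷ σ) = f≋g _
  D-additive zero    .cong f≋g (inside ∷ σ)  = refl
  D-additive (suc v) .cong f≋g (outside ∷ σ) = D-additive v .cong (λ _ → f≋g _) σ
  D-additive (suc v) .cong f≋g (inside ∷ σ)  = -‿cong (D-additive v .cong (λ _ → f≋g _) σ)
  D-additive zero    .homo-+ f g (outside ∷ σ) = refl
  D-additive zero    .homo-+ f g (inside ∷ σ)  = sym (+-identityʳ 0#)
  D-additive (suc v) .homo-+ f g (outside ∷ σ) = D-additive v .homo-+ _ _ σ
  D-additive (suc v) .homo-+ f g (inside ∷ σ)  =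
    trans (-‿cong (D-additive v .homo-+ _ _ σ)) (sym (-‿+-comm _ _))

  -- The splitting f = v g + h with g = `D v f`: the first summand carries the faces through `v`,
  -- the second those that avoid `v`.
  cone-D : (v : Fin n) (f : Chain n) → f ≋ cone v (D v f) ∔ D v (cone v f)
  cone-D zero    f (outside ∷ σ) = sym (+-identityˡ _)
  cone-D zero    f (inside ∷ σ)  = sym (+-identityʳ _)
  cone-D (suc v) f (outside ∷ σ) = cone-D v _ σ
  cone-D (suc v) f (inside ∷ σ)  = begin
    f (inside ∷ σ)
      ≈⟨ cone-D v f₁ σ ⟩
    cone v (D v f₁) σ + D v (cone v f₁) σ
      ≈⟨ solve (_ ∷ _ ∷ []) (v₀ ⊕ v₁) (⊝ (⊝ v₀) ⊕ ⊝ (⊝ v₁)) ≡.refl ⟩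
    - - cone v (D v f₁) σ - - D v (cone v f₁) σ
      ≈⟨ +-cong (-‿cong (homo-neg (cone-additive v) _ σ)) (-‿cong (homo-neg (D-additive v) _ σ)) ⟨
    - cone v (∸ D v f₁) σ - D v (∸ cone v f₁) σ ∎
    where f₁ = f ∘ (inside ∷_)

  -- The Leibniz rule for exterior multiplication by `v`, where the boundary of `v` is the empty
  -- face with coefficient one.
  ∂-cone : (v : Fin n) (f : Chain n) → ∂ᴷ (cone v f) ≋ f ∸ cone v (∂ᴷ f)
  ∂-cone zero f (outside ∷ τ) = begin
    ∂ᴷ (cone zero f) (outside ∷ τ)     ≈⟨ ∂-out (cone zero f) τ ⟩
    f (outside ∷ τ) + ∂ᴷ 0̇ τ           ≈⟨ +-congˡ (vanishes ∂-additive (λ _ → refl) τ) ⟩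
    f (outside ∷ τ) + 0#               ≈⟨ +-congˡ -0#≈0# ⟨
    f (outside ∷ τ) - 0#               ∎
  ∂-cone zero f (inside ∷ τ) = begin
    ∂ᴷ (cone zero f) (inside ∷ τ)      ≈⟨ ∂-in (cone zero f) τ ⟩
    - ∂ᴷ f₀ τ                          ≈⟨ solve (_ ∷ _ ∷ []) (⊝ v₁) (v₀ ⊝ (v₀ ⊕ v₁)) ≡.refl ⟩
    f (inside ∷ τ) - (f (inside ∷ τ) + ∂ᴷ f₀ τ)  ≈⟨ +-congˡ (-‿cong (∂-out f τ)) ⟨
    f (inside ∷ τ) - ∂ᴷ f (outside ∷ τ) ∎
    where f₀ = f ∘ (outside ∷_)
  ∂-cone (suc v) f (outside ∷ τ) = begin
    ∂ᴷ (cone (suc v) f) (outside ∷ τ)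
      ≈⟨ ∂-out (cone (suc v) f) τ ⟩
    - cone v f₁ τ + ∂ᴷ (cone v f₀) τ
      ≈⟨ +-congˡ (∂-cone v f₀ τ) ⟩
    - cone v f₁ τ + (f₀ τ - cone v (∂ᴷ f₀) τ)
      ≈⟨ solve (_ ∷ _ ∷ _ ∷ []) (⊝ v₀ ⊕ (v₁ ⊝ v₂)) (v₁ ⊝ (v₀ ⊕ v₂)) ≡.refl ⟩
    f₀ τ - (cone v f₁ τ + cone v (∂ᴷ f₀) τ)
      ≈⟨ +-congˡ (-‿cong (cone-additive v .homo-+ _ _ τ)) ⟨
    f₀ τ - cone v (f₁ ∔ ∂ᴷ f₀) τ
      ≈⟨ +-congˡ (-‿cong (cone-additive v .cong (∂-out f) τ)) ⟨
    f₀ τ - cone v (∂ᴷ f ∘ (outside ∷_)) τ ∎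
    where
    f₀ = f ∘ (outside ∷_)
    f₁ = f ∘ (inside ∷_)
  ∂-cone (suc v) f (inside ∷ τ) = begin
    ∂ᴷ (cone (suc v) f) (inside ∷ τ)
      ≈⟨ ∂-in (cone (suc v) f) τ ⟩
    - ∂ᴷ (∸ cone v f₁) τ
      ≈⟨ -‿cong (homo-neg ∂-additive _ τ) ⟩
    - - ∂ᴷ (cone v f₁) τ
      ≈⟨ -‿cong (-‿cong (∂-cone v f₁ τ)) ⟩
    - - (f₁ τ - cone v (∂ᴷ f₁) τ)
      ≈⟨ solve (_ ∷ _ ∷ []) (⊝ ⊝ (v₀ ⊝ v₁)) (v₀ ⊝ ⊝ ⊝ v₁) ≡.refl ⟩
    f₁ τ - - - cone v (∂ᴷ f₁) τ
      ≈⟨ +-congˡ (-‿cong (-‿cong (homo-neg (cone-additive v) _ τ))) ⟨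
    f₁ τ - - cone v (∸ ∂ᴷ f₁) τ
      ≈⟨ +-congˡ (-‿cong (-‿cong (cone-additive v .cong (∂-in f) τ))) ⟨
    f₁ τ - - cone v (∂ᴷ f ∘ (inside ∷_)) τ ∎
    where f₁ = f ∘ (inside ∷_)

  -- The boundary is the sum of the contractions by all vertices, and contractions anticommute.
  ∂-D : (v : Fin n) (f : Chain n) → ∂ᴷ (D v f) ≋ ∸ D v (∂ᴷ f)
  ∂-D zero f (outside ∷ τ) = begin
    ∂ᴷ (D zero f) (outside ∷ τ) ≈⟨ ∂-out (D zero f) τ ⟩
    0# + ∂ᴷ f₁ τ                ≈⟨ solve (_ ∷ []) (∅₀ ⊕ v₀) (⊝ ⊝ v₀) ≡.refl ⟩
    - - ∂ᴷ f₁ τ                 ≈⟨ -‿cong (∂-in f τ) ⟨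
    - ∂ᴷ f (inside ∷ τ)         ∎
    where f₁ = f ∘ (inside ∷_)
  ∂-D zero f (inside ∷ τ) =
    trans (∂-in (D zero f) τ) (-‿cong (vanishes ∂-additive (λ _ → refl) τ))
  ∂-D (suc v) f (outside ∷ τ) = begin
    ∂ᴷ (D (suc v) f) (outside ∷ τ)          ≈⟨ ∂-out (D (suc v) f) τ ⟩
    - D v f₁ τ + ∂ᴷ (D v f₀) τ              ≈⟨ +-congˡ (∂-D v f₀ τ) ⟩
    - D v f₁ τ - D v (∂ᴷ f₀) τ              ≈⟨ -‿+-comm _ _ ⟩
    - (D v f₁ τ + D v (∂ᴷ f₀) τ)            ≈⟨ -‿cong (D-additive v .homo-+ _ _ τ) ⟨
    - D v (f₁ ∔ ∂ᴷ f₀) τ                    ≈⟨ -‿cong (D-additive v .cong (∂-out f) τ) ⟨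
    - D v (∂ᴷ f ∘ (outside ∷_)) τ           ∎
    where
    f₀ = f ∘ (outside ∷_)
    f₁ = f ∘ (inside ∷_)
  ∂-D (suc v) f (inside ∷ τ) = begin
    ∂ᴷ (D (suc v) f) (inside ∷ τ)      ≈⟨ ∂-in (D (suc v) f) τ ⟩
    - ∂ᴷ (∸ D v f₁) τ                  ≈⟨ -‿cong (homo-neg ∂-additive _ τ) ⟩
    - - ∂ᴷ (D v f₁) τ                  ≈⟨ -‿cong (-‿cong (∂-D v f₁ τ)) ⟩
    - - - D v (∂ᴷ f₁) τ                ≈⟨ -‿cong (-‿cong (homo-neg (D-additive v) _ τ)) ⟨
    - - D v (∸ ∂ᴷ f₁) τ                ≈⟨ -‿cong (-‿cong (D-additive v .cong (∂-in f) τ)) ⟨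
    - - D v (∂ᴷ f ∘ (inside ∷_)) τ     ∎
    where f₁ = f ∘ (inside ∷_)

  -- Chains on the independence complex of an induced subgraph

  cone-support : (v : Fin n) {f : Chain n} {σ : Subset n} →
                 (v ∈ σ → f (σ ⁻ v) ≈ 0#) → cone v f σ ≈ 0#
  cone-support zero    {σ = outside ∷ σ} f≈0 = refl
  cone-support zero    {σ = inside  ∷ σ} f≈0 = f≈0 here
  cone-support (suc v) {σ = outside ∷ σ} f≈0 = cone-support v (f≈0 ∘ there)
  cone-support (suc v) {σ = inside  ∷ σ} f≈0 = trans (-‿cong (cone-support v (f≈0 ∘ there))) -0#≈0#

  D-support : (v : Fin n) {f : Chain n} {τ : Subset n} →
              (v ∉ τ → f (τ ⁺ v) ≈ 0#) → D v f τ ≈ 0#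
  D-support zero    {τ = outside ∷ τ} f≈0 = f≈0 λ ()
  D-support zero    {τ = inside  ∷ τ} f≈0 = refl
  D-support (suc v) {τ = outside ∷ τ} f≈0 = D-support v (λ v∉τ → f≈0 (v∉τ ∘ drop-there))
  D-support (suc v) {τ = inside  ∷ τ} f≈0 =
    trans (-‿cong (D-support v (λ v∉τ → f≈0 (v∉τ ∘ drop-there)))) -0#≈0#

  ∂-support : {f : Chain n} (τ : Subset n) → (∀ {v} → v ∉ τ → f (τ ⁺ v) ≈ 0#) → ∂ᴷ f τ ≈ 0#
  ∂-support []            f≈0 = ∂-[] _
  ∂-support (outside ∷ τ) f≈0 = begin
    ∂ᴷ _ (outside ∷ τ) ≈⟨ ∂-out _ τ ⟩
    _ + ∂ᴷ _ τ         ≈⟨ +-cong (f≈0 {zero} λ ()) (∂-support τ λ v∉τ → f≈0 (v∉τ ∘ drop-there)) ⟩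
    0# + 0#            ≈⟨ +-identityʳ 0# ⟩
    0#                 ∎
  ∂-support (inside ∷ τ)  f≈0 = begin
    ∂ᴷ _ (inside ∷ τ)  ≈⟨ ∂-in _ τ ⟩
    - ∂ᴷ _ τ           ≈⟨ -‿cong (∂-support τ λ v∉τ → f≈0 (v∉τ ∘ drop-there)) ⟩
    - 0#               ≈⟨ -0#≈0# ⟩
    0#                 ∎

  -- The summand h of the splitting `cone-D`, on faces that avoid `v`.
  off : Fin n → Chain n → Chain n
  off v f = D v (cone v f)

  off-id : (v : Fin n) {f : Chain n} → D v f ≋ 0̇ → off v f ≋ f
  off-id v {f} Df≋0 σ = begin
    off v f σ                        ≈⟨ +-identityˡ _ ⟨
    0# + off v f σ                   ≈⟨ +-congʳ (vanishes (cone-additive v) Df≋0 σ) ⟨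
    cone v (D v f) σ + off v f σ     ≈⟨ cone-D v f σ ⟨
    f σ                              ∎

  ∂-off : (v : Fin n) (f : Chain n) → ∂ᴷ (off v f) ≋ off v (∂ᴷ f) ∸ D v f
  ∂-off v f τ = begin
    ∂ᴷ (off v f) τ                        ≈⟨ ∂-D v (cone v f) τ ⟩
    - D v (∂ᴷ (cone v f)) τ               ≈⟨ -‿cong (D-additive v .cong (∂-cone v f) τ) ⟩
    - D v (f ∸ cone v (∂ᴷ f)) τ           ≈⟨ -‿cong (homo-− (D-additive v) _ _ τ) ⟩
    - (D v f τ - off v (∂ᴷ f) τ)          ≈⟨ solve (_ ∷ _ ∷ []) (⊝ (v₀ ⊝ v₁)) (v₁ ⊝ v₀) ≡.refl ⟩
    off v (∂ᴷ f) τ - D v f τ              ∎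

  ∂-cone-cycle : (v : Fin n) {f : Chain n} → ∂ᴷ f ≋ 0̇ → ∂ᴷ (cone v f) ≋ f
  ∂-cone-cycle v {f} ∂f≋0 τ = begin
    ∂ᴷ (cone v f) τ         ≈⟨ ∂-cone v f τ ⟩
    f τ - cone v (∂ᴷ f) τ   ≈⟨ +-congˡ (-‿cong (vanishes (cone-additive v) ∂f≋0 τ)) ⟩
    f τ - 0#                ≈⟨ solve (_ ∷ []) (v₀ ⊝ ∅₀) v₀ ≡.refl ⟩
    f τ                     ∎

  ∂-D-cycle : (v : Fin n) {f : Chain n} → ∂ᴷ f ≋ 0̇ → ∂ᴷ (D v f) ≋ 0̇
  ∂-D-cycle v {f} ∂f≋0 τ =
    trans (∂-D v f τ) (trans (-‿cong (vanishes (D-additive v) ∂f≋0 τ)) -0#≈0#)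

  -- On faces that avoid `v`, the boundary of v g + h is g + ∂h.
  ∂-off-cycle : (v : Fin n) {f : Chain n} → ∂ᴷ f ≋ 0̇ → ∂ᴷ (off v f) ≋ ∸ D v f
  ∂-off-cycle v {f} ∂f≋0 τ = begin
    ∂ᴷ (off v f) τ             ≈⟨ ∂-off v f τ ⟩
    off v (∂ᴷ f) τ - D v f τ   ≈⟨ +-congʳ (vanishes (D-additive v) (vanishes (cone-additive v) ∂f≋0) τ) ⟩
    0# - D v f τ               ≈⟨ +-identityˡ _ ⟩
    - D v f τ                  ∎

  ChainOn : Graph n → Subset n → ℕ → Chain n → Set ℓ
  ChainOn Γ S = IsChain 𝕜 (Face Γ S)

  -- Chains with one vertex less per face than j; there are none but 0 if j = 0.
  PreChainOn : Graph n → Subset n → ℕ → Chain n → Set ℓ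
  PreChainOn Γ S j f = ∀ σ → ¬ (Face Γ S σ × suc ∣ σ ∣ ≡ j) → f σ ≈ 0#

  -- `H̃≢0` for `Ind (Γ [ S ])`, restated with `Face` and the opaque boundary, so that all induced
  -- subgraphs share the ambient graph `Γ`.
  Nonzero : Graph n → Subset n → ℕ → Set (c ⊔ ℓ)
  Nonzero Γ S j = ∃[ f ] ChainOn Γ S j f × ∂ᴷ f ≋ 0̇ × (∀ g → ChainOn Γ S (suc j) g → ¬ (∂ᴷ g ≋ f))

  module _ {Γ : Graph n} where
    open Graph Γ using (_~_; ~-irrefl; ~⇒∈V; ~-sym)

    chain-mono : ∀ {R S j f} → R ⊆ S → ChainOn Γ R j f → ChainOn Γ S j f
    chain-mono R⊆S f-on σ σ∉ =
      f-on σ λ (F , ∣σ∣) → σ∉ (face (⊆V F) (R⊆S ∘ ⊆S F) (independent F) , ∣σ∣)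

    chain-∔ : ∀ {S j f g} → ChainOn Γ S j f → ChainOn Γ S j g → ChainOn Γ S j (f ∔ g)
    chain-∔ f-on g-on σ σ∉ = trans (+-cong (f-on σ σ∉) (g-on σ σ∉)) (+-identityʳ 0#)

    -- Unlike `ChainOn` this ignores the number of vertices, so a chain and its boundary satisfy it
    -- for the same `S`.
    SupportedOn : Subset n → Chain n → Set ℓ
    SupportedOn S f = ∀ σ → ¬ Face Γ S σ → f σ ≈ 0#

    chain⇒supported : ∀ {S j f} → ChainOn Γ S j f → SupportedOn S f
    chain⇒supported f-on σ σ∉ = f-on σ (σ∉ ∘ proj₁)

    ∂-supported : ∀ {S f} → SupportedOn S f → SupportedOn S (∂ᴷ f)
    ∂-supported f-on τ τ∉ = ∂-support τ λ _ → f-on _ λ F → τ∉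
      (face (⊆V F ∘ ∈⇒∈⁺) (⊆S F ∘ ∈⇒∈⁺) (λ u∈ w∈ → independent F (∈⇒∈⁺ u∈) (∈⇒∈⁺ w∈)))

    chain-neg : ∀ {S j f} → ChainOn Γ S j f → ChainOn Γ S j (∸ f)
    chain-neg f-on σ σ∉ = trans (-‿cong (f-on σ σ∉)) -0#≈0#

    chain⇒pre : ∀ {S j f} → ChainOn Γ S j f → PreChainOn Γ S (suc j) f
    chain⇒pre f-on σ σ∉ = f-on σ λ (F , ∣σ∣) → σ∉ (F , ≡.cong suc ∣σ∣)

    pre⇒chain : ∀ {S j f} → PreChainOn Γ S (suc j) f → ChainOn Γ S j f
    pre⇒chain f-on σ σ∉ = f-on σ λ (F , ∣σ∣) → σ∉ (F , suc-injective ∣σ∣)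

    pre-mono : ∀ {R S j f} → R ⊆ S → PreChainOn Γ R j f → PreChainOn Γ S j f
    pre-mono R⊆S f-on σ σ∉ =
      f-on σ λ (F , ∣σ∣) → σ∉ (face (⊆V F) (R⊆S ∘ ⊆S F) (independent F) , ∣σ∣)

    pre-neg : ∀ {S j f} → PreChainOn Γ S j f → PreChainOn Γ S j (∸ f)
    pre-neg f-on σ σ∉ = trans (-‿cong (f-on σ σ∉)) -0#≈0#

    -- Stated for pre-chains so that `j` may be zero, a case that `chain-φ` includes.
    pre-cone : ∀ {v R S j f} → v ∈ V Γ → v ∈ S → R ⊆ S → (∀ {u} → u ∈ R → ¬ (v ~ u)) →
               PreChainOn Γ R j f → ChainOn Γ S j (cone v f)
    pre-cone {v} {R} {S} v∈V v∈S R⊆S v≁R f-on σ σ∉ = cone-support v λ v∈σ →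
      f-on _ λ (F , ∣σ⁻v∣) → σ∉ (insert v∈σ F , ≡.trans (∣⁻∣ v∈σ) ∣σ⁻v∣)
      where
      insert : v ∈ σ → Face Γ R (σ ⁻ v) → Face Γ S σ
      insert v∈σ F = face
        (λ u∈σ → [ (λ { ≡.refl → v∈V }) , ⊆V F ]′ (split u∈σ))
        (λ u∈σ → [ (λ { ≡.refl → v∈S }) , R⊆S ∘ ⊆S F ]′ (split u∈σ))
        (λ u∈σ w∈σ u~w → separate (split u∈σ) (split w∈σ) u~w)
        where
        split : ∀ {u} → u ∈ σ → u ≡ v ⊎ u ∈ σ ⁻ v
        split {u} u∈σ with u ≟ v
        ... | yes u≡v = inj₁ u≡v
        ... | no  u≢v = inj₂ (∈⇒∈⁻ u∈σ u≢v)

        separate : ∀ {u w} → u ≡ v ⊎ u ∈ σ ⁻ v → w ≡ v ⊎ w ∈ σ ⁻ v → ¬ (u ~ w)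
        separate (inj₁ ≡.refl) (inj₁ ≡.refl) = ~-irrefl ≡.refl
        separate (inj₁ ≡.refl) (inj₂ w∈)     = v≁R (⊆S F w∈)
        separate (inj₂ u∈)     (inj₁ ≡.refl) = v≁R (⊆S F u∈) ∘ ~-sym
        separate (inj₂ u∈)     (inj₂ w∈)     = independent F u∈ w∈

    chain-cone : ∀ {v R S j f} → v ∈ V Γ → v ∈ S → R ⊆ S → (∀ {u} → u ∈ R → ¬ (v ~ u)) →
                 ChainOn Γ R j f → ChainOn Γ S (suc j) (cone v f)
    chain-cone v∈V v∈S R⊆S v≁R f-on = pre-cone v∈V v∈S R⊆S v≁R (chain⇒pre f-on)

    -- The other vertices of a face through `v` avoid the closed neighbourhood of `v`.
    pre-D : ∀ {v S j f} → ChainOn Γ S j f → PreChainOn Γ (lk Γ S v) j (D v f)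
    pre-D {v} f-on τ τ∉ = D-support v λ v∉τ → f-on _ λ (F , ∣τ⁺v∣) → τ∉
      ( face (⊆V F ∘ ∈⇒∈⁺)
             (λ u∈τ → ∈lk Γ (⊆S F (∈⇒∈⁺ u∈τ)) (λ { ≡.refl → v∉τ u∈τ })
                           (independent F (v∈S⁺v v τ) (∈⇒∈⁺ u∈τ)))
             (λ u∈τ w∈τ → independent F (∈⇒∈⁺ u∈τ) (∈⇒∈⁺ w∈τ))
      , ≡.trans (≡.sym (∣⁺∣ v∉τ)) ∣τ⁺v∣)

    chain-D : ∀ {v S j f} → ChainOn Γ S (suc j) f → ChainOn Γ (lk Γ S v) j (D v f)
    chain-D f-on = pre⇒chain (pre-D f-on)

    chain-off : ∀ {v S j f} → ChainOn Γ S j f → ChainOn Γ (S ⁻ v) j (off v f)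
    chain-off {v} {S} {j} {f} f-on τ τ∉ = D-support v λ v∉τ → cone-support v λ _ →
      ≡.subst (λ ρ → f ρ ≈ 0#) (≡.sym (⁺⁻-cancel v∉τ)) (f-on τ λ (F , ∣τ∣) → τ∉
        (face (⊆V F) (λ u∈τ → ∈⇒∈⁻ (⊆S F u∈τ) λ { ≡.refl → v∉τ u∈τ }) (independent F) , ∣τ∣))

    D≋0 : ∀ {v S j f} → v ∉ S → ChainOn Γ S j f → D v f ≋ 0̇
    D≋0 {v} v∉S f-on τ = D-support v λ _ → f-on _ λ (F , _) → v∉S (⊆S F (v∈S⁺v v τ))

    -- Nonzero homology under deletion, link, insertion and a disjoint edge

    ∈lk⇒∈⁻ : ∀ {S u v} → u ∈ lk Γ S v → u ∈ S ⁻ v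
    ∈lk⇒∈⁻ u∈lk = ∈⇒∈⁻ (lk⊆ Γ u∈lk) (lk-≢ Γ u∈lk)

    -- With f = v * g + h, a primitive w of g = D v f would make h + w a cycle off v
    -- homologous to f.
    nonzero-link : ∀ {v S j} → v ∈ V Γ → v ∈ S →
                   Nonzero Γ S (suc j) → ¬ Nonzero Γ (S ⁻ v) (suc j) → Nonzero Γ (lk Γ S v) j
    nonzero-link {v} {S} {j} v∈V v∈S (f , f-on , ∂f≋0 , f-nb) zero⁻ =
      D v f , chain-D f-on , ∂-D-cycle v ∂f≋0 , D-nb
      where
      D-nb : ∀ w → ChainOn Γ (lk Γ S v) (suc j) w → ¬ (∂ᴷ w ≋ D v f)
      D-nb w w-on ∂w≋Df =
        zero⁻ (off v f ∔ w , chain-∔ (chain-off f-on) (chain-mono ∈lk⇒∈⁻ w-on) , cycle , nb)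
        where
        cycle : ∂ᴷ (off v f ∔ w) ≋ 0̇
        cycle τ = begin
          ∂ᴷ (off v f ∔ w) τ        ≈⟨ ∂-additive .homo-+ _ _ τ ⟩
          ∂ᴷ (off v f) τ + ∂ᴷ w τ   ≈⟨ +-cong (∂-off-cycle v ∂f≋0 τ) (∂w≋Df τ) ⟩
          - D v f τ + D v f τ       ≈⟨ -‿inverseˡ _ ⟩
          0#                        ∎

        nb : ∀ u → ChainOn Γ (S ⁻ v) (suc (suc j)) u → ¬ (∂ᴷ u ≋ off v f ∔ w)
        -- From ∂u = h + w and ∂w = g, the boundary of u - v w is (h + w) - (w - v g) = f.
        nb u u-on ∂u = f-nb (u ∸ cone v w)
          (chain-∔ (chain-mono ∈⁻⇒∈ u-on) (chain-neg (chain-cone v∈V v∈S (lk⊆ Γ) (lk-≁ Γ) w-on)))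
          λ τ → begin
            ∂ᴷ (u ∸ cone v w) τ
              ≈⟨ homo-− ∂-additive _ _ τ ⟩
            ∂ᴷ u τ - ∂ᴷ (cone v w) τ
              ≈⟨ +-cong (∂u τ) (-‿cong (∂-cone v w τ)) ⟩
            off v f τ + w τ - (w τ - cone v (∂ᴷ w) τ)
              ≈⟨ +-congˡ (-‿cong (+-congˡ (-‿cong (cone-additive v .cong ∂w≋Df τ)))) ⟩
            off v f τ + w τ - (w τ - cone v (D v f) τ)
              ≈⟨ solve (_ ∷ _ ∷ _ ∷ []) (v₀ ⊕ v₁ ⊝ (v₁ ⊝ v₂)) (v₂ ⊕ v₀) ≡.refl ⟩
            cone v (D v f) τ + off v f τ
              ≈⟨ cone-D v f τ ⟨
            f τ ∎

    -- The complex is a cone with apex `v`, so `cone v` supplies a primitive of every cycle.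
    zero-isolated : ∀ {v S j} → v ∈ V Γ → v ∈ S → (∀ {u} → u ∈ S → ¬ (v ~ u)) → ¬ Nonzero Γ S j
    zero-isolated {v} v∈V v∈S v≁S (f , f-on , ∂f≋0 , f-nb) =
      f-nb (cone v f) (chain-cone v∈V v∈S (λ u∈S → u∈S) v≁S f-on) (∂-cone-cycle v ∂f≋0)

    -- If `f` acquires a primitive `e` on `S`, then `D v e` is a cycle of the link. It cannot be a
    -- boundary ∂u, as `off v e ∔ u` would then be a primitive of `f` avoiding `v`.
    nonzero-insert : ∀ {v S j} → Nonzero Γ (S ⁻ v) j → ¬ Nonzero Γ (lk Γ S v) j → Nonzero Γ S j
    nonzero-insert {v} {S} {j} (f , f-on , ∂f≋0 , f-nb) zero-lk =
      f , chain-mono ∈⁻⇒∈ f-on , ∂f≋0 , nb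
      where
      Df≋0 : D v f ≋ 0̇
      Df≋0 = D≋0 (v∉S⁻v v S) f-on

      nb : ∀ e → ChainOn Γ S (suc j) e → ¬ (∂ᴷ e ≋ f)
      nb e e-on ∂e≋f = zero-lk (D v e , chain-D e-on , cycle , D-nb)
        where
        cycle : ∂ᴷ (D v e) ≋ 0̇
        cycle τ = begin
          ∂ᴷ (D v e) τ     ≈⟨ ∂-D v e τ ⟩
          - D v (∂ᴷ e) τ   ≈⟨ -‿cong (D-additive v .cong ∂e≋f τ) ⟩
          - D v f τ        ≈⟨ -‿cong (Df≋0 τ) ⟩
          - 0#             ≈⟨ -0#≈0# ⟩
          0#               ∎

        D-nb : ∀ u → ChainOn Γ (lk Γ S v) (suc j) u → ¬ (∂ᴷ u ≋ D v e)
        D-nb u u-on ∂u≋De =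
          f-nb (off v e ∔ u) (chain-∔ (chain-off e-on) (chain-mono ∈lk⇒∈⁻ u-on)) λ τ → begin
            ∂ᴷ (off v e ∔ u) τ
              ≈⟨ ∂-additive .homo-+ _ _ τ ⟩
            ∂ᴷ (off v e) τ + ∂ᴷ u τ
              ≈⟨ +-cong (∂-off v e τ) (∂u≋De τ) ⟩
            off v (∂ᴷ e) τ - D v e τ + D v e τ
              ≈⟨ solve (_ ∷ _ ∷ []) (v₀ ⊝ v₁ ⊕ v₁) v₀ ≡.refl ⟩
            off v (∂ᴷ e) τ
              ≈⟨ D-additive v .cong (cone-additive v .cong ∂e≋f) τ ⟩
            off v f τ
              ≈⟨ off-id v Df≋0 τ ⟩
            f τ ∎

    -- The independence complex of an edge is two points, so a disjoint edge suspends the complex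
    -- and `f` becomes p f - q f. Contracting a primitive of the latter by `p` gives, up to sign, a
    -- primitive of `f`; it avoids `q` because `q` is adjacent to `p`.
    nonzero-edge : ∀ {p q S j} → p ~ q → p ∉ S → q ∉ S →
                   (∀ {u} → u ∈ S → ¬ (p ~ u)) → (∀ {u} → u ∈ S → ¬ (q ~ u)) →
                   Nonzero Γ S j → Nonzero Γ (S ⁺ p ⁺ q) (suc j)
    nonzero-edge {p} {q} {S} {j} p~q p∉S q∉S p≁S q≁S (f , f-on , ∂f≋0 , f-nb) =
      cone p f ∸ cone q f
      , chain-∔ (chain-cone (~⇒∈V p~q) (∈⇒∈⁺ (v∈S⁺v p S)) S⊆S⁺ p≁S f-on)
                (chain-neg (chain-cone (~⇒∈V (~-sym p~q)) (v∈S⁺v q _) S⊆S⁺ q≁S f-on))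
      , cycle , nb
      where
      S⊆S⁺ : S ⊆ S ⁺ p ⁺ q
      S⊆S⁺ u∈S = ∈⇒∈⁺ (∈⇒∈⁺ u∈S)

      cycle : ∂ᴷ (cone p f ∸ cone q f) ≋ 0̇
      cycle τ = begin
        ∂ᴷ (cone p f ∸ cone q f) τ            ≈⟨ homo-− ∂-additive _ _ τ ⟩
        ∂ᴷ (cone p f) τ - ∂ᴷ (cone q f) τ
          ≈⟨ +-cong (∂-cone-cycle p ∂f≋0 τ) (-‿cong (∂-cone-cycle q ∂f≋0 τ)) ⟩
        f τ - f τ                             ≈⟨ -‿inverseʳ _ ⟩
        0#                                    ∎

      lk⊆S : ∀ {u} → u ∈ lk Γ (S ⁺ p ⁺ q) p → u ∈ S
      lk⊆S u∈lk with ∈⁺⇒≡∨∈ (lk⊆ Γ u∈lk)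
      ... | inj₁ ≡.refl = ⊥-elim (lk-≁ Γ u∈lk p~q)
      ... | inj₂ u∈S⁺p with ∈⁺⇒≡∨∈ u∈S⁺p
      ...   | inj₁ u≡p = ⊥-elim (lk-≢ Γ u∈lk u≡p)
      ...   | inj₂ u∈S = u∈S

      D-cone-q : D p (cone q f) ≋ 0̇
      D-cone-q τ = D-support p λ _ → cone-support q λ _ → f-on _ λ (F , _) →
        p∉S (⊆S F (∈⇒∈⁻ (v∈S⁺v p τ) λ p≡q → ~-irrefl p≡q p~q))

      nb : ∀ e → ChainOn Γ (S ⁺ p ⁺ q) (suc (suc j)) e → ¬ (∂ᴷ e ≋ cone p f ∸ cone q f)
      nb e e-on ∂e = f-nb (∸ D p e) (chain-neg (chain-mono lk⊆S (chain-D e-on))) λ τ → begin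
        ∂ᴷ (∸ D p e) τ                      ≈⟨ homo-neg ∂-additive _ τ ⟩
        - ∂ᴷ (D p e) τ                      ≈⟨ -‿cong (∂-D p e τ) ⟩
        - - D p (∂ᴷ e) τ                    ≈⟨ -‿cong (-‿cong (D-additive p .cong ∂e τ)) ⟩
        - - D p (cone p f ∸ cone q f) τ     ≈⟨ -‿cong (-‿cong (homo-− (D-additive p) _ _ τ)) ⟩
        - - (off p f τ - D p (cone q f) τ)
          ≈⟨ -‿cong (-‿cong (+-cong (off-id p (D≋0 p∉S f-on) τ) (-‿cong (D-cone-q τ)))) ⟩
        - - (f τ - 0#)                      ≈⟨ solve (_ ∷ []) (⊝ ⊝ (v₀ ⊝ ∅₀)) v₀ ≡.refl ⟩
        f τ                                 ∎

  -- Lozin transforms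

  module LozinHomology {n : ℕ} (G : Graph n) (x : Fin n) (x∈V : x ∈ V G)
                       (Y Z : Subset n) (N≡Y∪Z : N G x ≡ Y ∪ Z) where
    open LozinGraph G x x∈V Y Z N≡Y∪Z

    -- The boundary operator on the eight path components

    module Boundary {T : Subset (suc (suc (suc (suc n))))} (c : Chain (suc (suc (suc (suc n)))))
                    (c-on : SupportedOn {Γ = L} T c) where

      -- The four values are parameters so that `∂-restrict` can set them to zero.
      ∂₄ : ∀ {A B C E} σ → c (𝕪∪ σ) ≈ A → c (𝕒∪ σ) ≈ B → c (𝕓∪ σ) ≈ C → c (𝕫∪ σ) ≈ E →
           ∂ᴷ c (none σ) ≈ A + (B + (C + (E + ∂ᴷ (λ ρ → c (none ρ)) σ)))
      ∂₄ σ A B C E =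
        trans (∂-out c _) (+-cong A (
        trans (∂-out _ _) (+-cong B (
        trans (∂-out _ _) (+-cong C (
        trans (∂-out _ _) (+-congʳ E)))))))

      ∂-none : ∀ σ → ∂ᴷ c (none σ) ≈
               c (𝕪∪ σ) + (c (𝕒∪ σ) + (c (𝕓∪ σ) + (c (𝕫∪ σ) + ∂ᴷ (λ ρ → c (none ρ)) σ)))
      ∂-none σ = ∂₄ σ refl refl refl refl

      -- Signs count the path vertices in front of the inserted vertex, and components over path
      -- sets containing an edge vanish; the formulas below follow the same pattern.
      ∂-𝕪 : ∀ σ → ∂ᴷ c (𝕪∪ σ) ≈ - (c (𝕪𝕓∪ σ) + (c (𝕪𝕫∪ σ) + ∂ᴷ (λ ρ → c (𝕪∪ ρ)) σ))
      ∂-𝕪 σ = begin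
        ∂ᴷ c (𝕪∪ σ)
          ≈⟨ trans (∂-in c _) (-‿cong (trans (∂-out _ _) (+-cong (c-on _ ∌𝕪𝕒) (
             trans (∂-out _ _) (+-congˡ (∂-out _ _)))))) ⟩
        - (0# + (c (𝕪𝕓∪ σ) + (c (𝕪𝕫∪ σ) + ∂ᴷ (λ ρ → c (𝕪∪ ρ)) σ)))
          ≈⟨ -‿cong (+-identityˡ _) ⟩
        - (c (𝕪𝕓∪ σ) + (c (𝕪𝕫∪ σ) + ∂ᴷ (λ ρ → c (𝕪∪ ρ)) σ)) ∎

      ∂-𝕒 : ∀ σ → ∂ᴷ c (𝕒∪ σ) ≈ - (c (𝕒𝕫∪ σ) + ∂ᴷ (λ ρ → c (𝕒∪ ρ)) σ)
      ∂-𝕒 σ = begin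
        ∂ᴷ c (𝕒∪ σ)
          ≈⟨ trans (∂-out c _) (+-cong (c-on _ ∌𝕪𝕒) (trans (∂-in _ _) (-‿cong (
             trans (∂-out _ _) (+-cong (c-on _ ∌𝕒𝕓) (∂-out _ _)))))) ⟩
        0# - (0# + (c (𝕒𝕫∪ σ) + ∂ᴷ (λ ρ → c (𝕒∪ ρ)) σ))
          ≈⟨ solve (_ ∷ []) (∅₀ ⊝ (∅₀ ⊕ v₀)) (⊝ v₀) ≡.refl ⟩
        - (c (𝕒𝕫∪ σ) + ∂ᴷ (λ ρ → c (𝕒∪ ρ)) σ) ∎

      ∂-𝕓 : ∀ σ → ∂ᴷ c (𝕓∪ σ) ≈ c (𝕪𝕓∪ σ) - ∂ᴷ (λ ρ → c (𝕓∪ ρ)) σ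
      ∂-𝕓 σ = begin
        ∂ᴷ c (𝕓∪ σ)
          ≈⟨ trans (∂-out c _) (+-congˡ (trans (∂-out _ _) (+-cong (c-on _ ∌𝕒𝕓) (
             trans (∂-in _ _) (-‿cong (trans (∂-out _ _) (+-congʳ (c-on _ ∌𝕓𝕫)))))))) ⟩
        c (𝕪𝕓∪ σ) + (0# - (0# + ∂ᴷ (λ ρ → c (𝕓∪ ρ)) σ))
          ≈⟨ solve (_ ∷ _ ∷ []) (v₀ ⊕ (∅₀ ⊝ (∅₀ ⊕ v₁))) (v₀ ⊝ v₁) ≡.refl ⟩
        c (𝕪𝕓∪ σ) - ∂ᴷ (λ ρ → c (𝕓∪ ρ)) σ ∎

      ∂-𝕫 : ∀ σ → ∂ᴷ c (𝕫∪ σ) ≈ c (𝕪𝕫∪ σ) + (c (𝕒𝕫∪ σ) - ∂ᴷ (λ ρ → c (𝕫∪ ρ)) σ)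
      ∂-𝕫 σ = begin
        ∂ᴷ c (𝕫∪ σ)
          ≈⟨ trans (∂-out c _) (+-congˡ (trans (∂-out _ _) (+-congˡ (
             trans (∂-out _ _) (+-cong (c-on _ ∌𝕓𝕫) (∂-in _ _)))))) ⟩
        c (𝕪𝕫∪ σ) + (c (𝕒𝕫∪ σ) + (0# - ∂ᴷ (λ ρ → c (𝕫∪ ρ)) σ))
          ≈⟨ +-congˡ (+-congˡ (+-identityˡ _)) ⟩
        c (𝕪𝕫∪ σ) + (c (𝕒𝕫∪ σ) - ∂ᴷ (λ ρ → c (𝕫∪ ρ)) σ) ∎

      ∂-𝕪𝕓 : ∀ σ → ∂ᴷ c (𝕪𝕓∪ σ) ≈ ∂ᴷ (λ ρ → c (𝕪𝕓∪ ρ)) σ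
      ∂-𝕪𝕓 σ = begin
        ∂ᴷ c (𝕪𝕓∪ σ)
          ≈⟨ trans (∂-in c _) (-‿cong (trans (∂-out _ _) (+-cong (c-on _ ∌𝕪𝕒) (
             trans (∂-in _ _) (-‿cong (trans (∂-out _ _) (+-congʳ (c-on _ ∌𝕓𝕫)))))))) ⟩
        - (0# - (0# + ∂ᴷ (λ ρ → c (𝕪𝕓∪ ρ)) σ))
          ≈⟨ solve (_ ∷ []) (⊝ (∅₀ ⊝ (∅₀ ⊕ v₀))) v₀ ≡.refl ⟩
        ∂ᴷ (λ ρ → c (𝕪𝕓∪ ρ)) σ ∎

      ∂-𝕪𝕫 : ∀ σ → ∂ᴷ c (𝕪𝕫∪ σ) ≈ ∂ᴷ (λ ρ → c (𝕪𝕫∪ ρ)) σ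
      ∂-𝕪𝕫 σ = begin
        ∂ᴷ c (𝕪𝕫∪ σ)
          ≈⟨ trans (∂-in c _) (-‿cong (trans (∂-out _ _) (+-cong (c-on _ ∌𝕪𝕒) (
             trans (∂-out _ _) (+-cong (c-on _ ∌𝕓𝕫) (∂-in _ _)))))) ⟩
        - (0# + (0# - ∂ᴷ (λ ρ → c (𝕪𝕫∪ ρ)) σ))
          ≈⟨ solve (_ ∷ []) (⊝ (∅₀ ⊕ (∅₀ ⊝ v₀))) v₀ ≡.refl ⟩
        ∂ᴷ (λ ρ → c (𝕪𝕫∪ ρ)) σ ∎

      ∂-𝕒𝕫 : ∀ σ → ∂ᴷ c (𝕒𝕫∪ σ) ≈ ∂ᴷ (λ ρ → c (𝕒𝕫∪ ρ)) σ
      ∂-𝕒𝕫 σ = begin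
        ∂ᴷ c (𝕒𝕫∪ σ)
          ≈⟨ trans (∂-out c _) (+-cong (c-on _ ∌𝕪𝕒) (trans (∂-in _ _) (-‿cong (
             trans (∂-out _ _) (+-cong (c-on _ ∌𝕒𝕓) (∂-in _ _)))))) ⟩
        0# - (0# - ∂ᴷ (λ ρ → c (𝕒𝕫∪ ρ)) σ)
          ≈⟨ solve (_ ∷ []) (∅₀ ⊝ (∅₀ ⊝ v₀)) v₀ ≡.refl ⟩
        ∂ᴷ (λ ρ → c (𝕒𝕫∪ ρ)) σ ∎

    by-cases : ∀ {T} {c e : Chain (suc (suc (suc (suc n))))} →
               SupportedOn {Γ = L} T c → SupportedOn {Γ = L} T e →
               (∀ σ → c (none σ) ≈ e (none σ)) → (∀ σ → c (𝕪∪ σ) ≈ e (𝕪∪ σ)) →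
               (∀ σ → c (𝕒∪ σ) ≈ e (𝕒∪ σ)) → (∀ σ → c (𝕓∪ σ) ≈ e (𝕓∪ σ)) →
               (∀ σ → c (𝕫∪ σ) ≈ e (𝕫∪ σ)) → (∀ σ → c (𝕪𝕓∪ σ) ≈ e (𝕪𝕓∪ σ)) →
               (∀ σ → c (𝕪𝕫∪ σ) ≈ e (𝕪𝕫∪ σ)) → (∀ σ → c (𝕒𝕫∪ σ) ≈ e (𝕒𝕫∪ σ)) → c ≋ e
    by-cases c-on e-on c₀ cy ca cb cz cyb cyz caz = λ where
      (none σ)   → c₀ σ
      (𝕪∪ σ)     → cy σ
      (𝕒∪ σ)     → ca σ
      (𝕓∪ σ)     → cb σ
      (𝕫∪ σ)     → cz σ
      (𝕪𝕓∪ σ)    → cyb σ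
      (𝕪𝕫∪ σ)    → cyz σ
      (𝕒𝕫∪ σ)    → caz σ
      (𝕪𝕒 s t σ) → trans (c-on _ ∌𝕪𝕒) (sym (e-on _ ∌𝕪𝕒))
      (𝕒𝕓 t σ)   → trans (c-on _ ∌𝕒𝕓) (sym (e-on _ ∌𝕒𝕓))
      (𝕪𝕓𝕫 σ)    → trans (c-on _ ∌𝕓𝕫) (sym (e-on _ ∌𝕓𝕫))
      (𝕓𝕫 σ)     → trans (c-on _ ∌𝕓𝕫) (sym (e-on _ ∌𝕓𝕫))

    -- Induced subgraphs without new vertices

    extend : Chain n → Chain (suc (suc (suc (suc n))))
    extend f (none σ)                                = f σ
    extend f (inside ∷ _)                            = 0#
    extend f (outside ∷ inside ∷ _)                  = 0#
    extend f (outside ∷ outside ∷ inside ∷ _)        = 0#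
    extend f (outside ∷ outside ∷ outside ∷ inside ∷ _) = 0#

    restrict : Chain (suc (suc (suc (suc n)))) → Chain n
    restrict c σ = c (none σ)

    chain-extend : ∀ {S j f} → x ∉ S → ChainOn G S j f → ChainOn L (none S) j (extend f)
    chain-extend x∉S f-on (none σ) σ∉ = f-on σ λ (F , ∣σ∣) → σ∉ (face-none x∉S F , ∣σ∣)
    chain-extend x∉S f-on (inside ∷ _)                               σ∉ = refl
    chain-extend x∉S f-on (outside ∷ inside ∷ _)                     σ∉ = refl
    chain-extend x∉S f-on (outside ∷ outside ∷ inside ∷ _)           σ∉ = refl
    chain-extend x∉S f-on (outside ∷ outside ∷ outside ∷ inside ∷ _) σ∉ = refl

    chain-restrict : ∀ {s₀ s₁ s₂ s₃ S j c} →
                     ChainOn L (s₀ ∷ s₁ ∷ s₂ ∷ s₃ ∷ S) j c → ChainOn G S j (restrict c)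
    chain-restrict c-on σ σ∉ = c-on (none σ) λ (F , ∣σ∣) → σ∉ (face-old F , ∣σ∣)

    ∂-restrict : ∀ {S c} → SupportedOn {Γ = L} (none S) c → ∀ σ → ∂ᴷ c (none σ) ≈ ∂ᴷ (restrict c) σ
    ∂-restrict {S} {c} c-on σ = begin
      ∂ᴷ c (none σ)
        ≈⟨ Boundary.∂₄ c c-on σ (c-on _ λ F → ∌-𝕪 (⊆S F here)) (c-on _ λ F → ∌-𝕒 (⊆S F (there here)))
             (c-on _ λ F → ∌-𝕓 (⊆S F (there (there here))))
             (c-on _ λ F → ∌-𝕫 (⊆S F (there (there (there here))))) ⟩
      0# + (0# + (0# + (0# + ∂ᴷ (restrict c) σ)))
        ≈⟨ solve (_ ∷ []) (∅₀ ⊕ (∅₀ ⊕ (∅₀ ⊕ (∅₀ ⊕ v₀)))) v₀ ≡.refl ⟩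
      ∂ᴷ (restrict c) σ ∎
      where
      ∌-𝕪 : 𝕪 ∉ none S
      ∌-𝕪 ()
      ∌-𝕒 : 𝕒 ∉ none S
      ∌-𝕒 (there ())
      ∌-𝕓 : 𝕓 ∉ none S
      ∌-𝕓 (there (there ()))
      ∌-𝕫 : 𝕫 ∉ none S
      ∌-𝕫 (there (there (there ())))

    extend-unique : ∀ {S c f} → SupportedOn {Γ = L} (none S) c →
                    (∀ σ → c (none σ) ≈ f σ) → c ≋ extend f
    extend-unique c-on c≈f (none σ) = c≈f σ
    extend-unique c-on c≈f (inside ∷ _) = c-on _ λ F → case ⊆S F here of λ ()
    extend-unique c-on c≈f (outside ∷ inside ∷ _) = c-on _ λ F → case ⊆S F (there here) of λ { (there ()) }
    extend-unique c-on c≈f (outside ∷ outside ∷ inside ∷ _) =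
      c-on _ λ F → case ⊆S F (there (there here)) of λ { (there (there ())) }
    extend-unique c-on c≈f (outside ∷ outside ∷ outside ∷ inside ∷ _) =
      c-on _ λ F → case ⊆S F (there (there (there here))) of λ { (there (there (there ()))) }

    ∂-extend : ∀ {S f} → x ∉ S → SupportedOn {Γ = G} S f → ∂ᴷ (extend f) ≋ extend (∂ᴷ f)
    ∂-extend {S} {f} x∉S f-on = extend-unique (∂-supported ext-on) (∂-restrict ext-on)
      where
      ext-on : SupportedOn {Γ = L} (none S) (extend f)
      ext-on (none σ) σ∉                                  = f-on σ (σ∉ ∘ face-none x∉S)
      ext-on (inside ∷ _) σ∉                              = refl
      ext-on (outside ∷ inside ∷ _) σ∉                    = refl
      ext-on (outside ∷ outside ∷ inside ∷ _) σ∉          = refl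
      ext-on (outside ∷ outside ∷ outside ∷ inside ∷ _) σ∉ = refl

    nonzero-extend : ∀ {S j} → x ∉ S → Nonzero G S j → Nonzero L (none S) j
    nonzero-extend {S} {j} x∉S (f , f-on , ∂f≋0 , f-nb) =
      extend f , chain-extend x∉S f-on , cycle , nb
      where
      cycle : ∂ᴷ (extend f) ≋ 0̇
      cycle = λ τ → trans (∂-extend x∉S (chain⇒supported f-on) τ)
                          (sym (extend-unique {S} {f = ∂ᴷ f} (λ _ _ → refl) (λ σ → sym (∂f≋0 σ)) τ))

      nb : ∀ g → ChainOn L (none S) (suc j) g → ¬ (∂ᴷ g ≋ extend f)
      nb g g-on ∂g≋f = f-nb (restrict g) (chain-restrict g-on) λ σ →
        trans (sym (∂-restrict (chain⇒supported g-on) σ)) (∂g≋f (none σ))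

    nonzero-restrict : ∀ {S j} → x ∉ S → Nonzero L (none S) j → Nonzero G S j
    nonzero-restrict {S} {j} x∉S (f , f-on , ∂f≋0 , f-nb) =
      restrict f , chain-restrict f-on
      , (λ σ → trans (sym (∂-restrict (chain⇒supported f-on) σ)) (∂f≋0 (none σ))) , nb
      where
      nb : ∀ g → ChainOn G S (suc j) g → ¬ (∂ᴷ g ≋ restrict f)
      nb g g-on ∂g≋f = f-nb (extend g) (chain-extend x∉S g-on) λ τ → begin
        ∂ᴷ (extend g) τ       ≈⟨ ∂-extend x∉S (chain⇒supported g-on) τ ⟩
        extend (∂ᴷ g) τ       ≈⟨ extend-unique (chain⇒supported f-on) (λ σ → sym (∂g≋f σ)) τ ⟨
        f τ                   ∎

    -- Induced subgraphs with all new vertices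

    module _ {S : Subset n} (x∉S : x ∉ S) where

      private
        -- The old vertices compatible with both `𝕪` and `𝕫`, with `𝕪`, and with `𝕫`. Since the
        -- neighbourhood of `x` is `Y ∪ Z`, the first set is the link of `x`, which is what ties
        -- ℒ(G) to G.
        R R-Y R-Z : Subset n
        R   = lk G (S ⁺ x) x
        R-Y = S ∩ ∁ Y
        R-Z = S ∩ ∁ Z

      R⊆S : R ⊆ S
      R⊆S u∈R with ∈⁺⇒≡∨∈ (lk⊆ G u∈R)
      ... | inj₁ u≡x = ⊥-elim (lk-≢ G u∈R u≡x)
      ... | inj₂ u∈S = u∈S

      R⊆R-Y : R ⊆ R-Y
      R⊆R-Y u∈R = x∈p∩q⁺ (R⊆S u∈R , x∉p⇒x∈∁p λ u∈Y → lk-≁ G u∈R (∈Y⇒~ u∈Y))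

      R⊆R-Z : R ⊆ R-Z
      R⊆R-Z u∈R = x∈p∩q⁺ (R⊆S u∈R , x∉p⇒x∈∁p λ u∈Z → lk-≁ G u∈R (∈Z⇒~ u∈Z))

      S⊆S⁺x : S ⊆ S ⁺ x
      S⊆S⁺x u∈S = ∈⇒∈⁺ u∈S

      face-R : ∀ {T σ} → Face L T (𝕪𝕫∪ σ) → Face G S σ → Face G R σ
      face-R F F′ = face (⊆V F′)
        (λ u∈σ → ∈lk G (∈⇒∈⁺ (⊆S F′ u∈σ)) (λ { ≡.refl → x∉S (⊆S F′ u∈σ) })
                      λ x~u → [ face-∉Y F u∈σ , face-∉Z F u∈σ ]′ (~⇒∈Y∪Z x~u))
        (independent F′)

      module Components {j} {c : Chain (suc (suc (suc (suc n))))}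
                        (c-on : ChainOn L (full S) (suc j) c) where
        on-none : ChainOn G S (suc j) (λ σ → c (none σ))
        on-none σ σ∉ = c-on _ λ (F , eq) → σ∉ (face-old F , eq)

        on-𝕪 : ChainOn G R-Y j (λ σ → c (𝕪∪ σ))
        on-𝕪 σ σ∉ = c-on _ λ (F , eq) → σ∉ (face-∩ (face-old F) (face-∉Y F) , suc-injective eq)

        on-𝕓 : ChainOn G S j (λ σ → c (𝕓∪ σ))
        on-𝕓 σ σ∉ = c-on _ λ (F , eq) → σ∉ (face-old F , suc-injective eq)

        on-𝕫 : ChainOn G R-Z j (λ σ → c (𝕫∪ σ))
        on-𝕫 σ σ∉ = c-on _ λ (F , eq) → σ∉ (face-∩ (face-old F) (face-∉Z F) , suc-injective eq)

        -- Two path vertices are removed from faces with `suc j` vertices, so nothing is left when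
        -- `j` is zero.
        on-𝕪𝕫 : PreChainOn G R j (λ σ → c (𝕪𝕫∪ σ))
        on-𝕪𝕫 σ σ∉ = c-on _ λ (F , eq) → σ∉ (face-R F (face-old F) , suc-injective eq)

      -- The chain a α + b β + yb γ + yz δ + az ζ.
      assemble : (α β γ δ ζ : Chain n) → Chain (suc (suc (suc (suc n))))
      assemble α β γ δ ζ (none σ)   = 0#
      assemble α β γ δ ζ (𝕪∪ σ)     = 0#
      assemble α β γ δ ζ (𝕒∪ σ)     = α σ
      assemble α β γ δ ζ (𝕓∪ σ)     = β σ
      assemble α β γ δ ζ (𝕫∪ σ)     = 0#
      assemble α β γ δ ζ (𝕪𝕓∪ σ)    = γ σ
      assemble α β γ δ ζ (𝕪𝕫∪ σ)    = δ σ
      assemble α β γ δ ζ (𝕒𝕫∪ σ)    = ζ σ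
      assemble α β γ δ ζ (𝕪𝕒 s t σ) = 0#
      assemble α β γ δ ζ (𝕒𝕓 t σ)   = 0#
      assemble α β γ δ ζ (𝕪𝕓𝕫 σ)    = 0#
      assemble α β γ δ ζ (𝕓𝕫 σ)     = 0#

      module _ {j} {α β γ δ ζ : Chain n}
               (α-on : ChainOn G S j α) (β-on : ChainOn G S j β) (γ-on : PreChainOn G R-Y j γ)
               (δ-on : PreChainOn G R j δ) (ζ-on : PreChainOn G R-Z j ζ) where

        private
          ∩∁⇒∉ : ∀ {W u} → u ∈ S ∩ ∁ W → u ∉ W
          ∩∁⇒∉ {W} u∈ = x∈∁p⇒x∉p (proj₂ (x∈p∩q⁻ S (∁ W) u∈))

          ∩⇒∈ : ∀ {W u} → u ∈ S ∩ W → u ∈ S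
          ∩⇒∈ {W} u∈ = proj₁ (x∈p∩q⁻ S W u∈)

          new : ∀ {t₀ t₁ t₂ t₃ T σ} → PathIndependent t₀ t₁ t₂ t₃ → T ⊆ S →
                (t₀ ≡ inside → ∀ {u} → u ∈ T → u ∉ Y) → (t₃ ≡ inside → ∀ {u} → u ∈ T → u ∉ Z) →
                Face G T σ → Face L (full S) (t₀ ∷ t₁ ∷ t₂ ∷ t₃ ∷ σ)
          new ind T⊆S ∉Y ∉Z F = face-new (x∉S ∘ T⊆S) ind (⊆full (T⊆S ∘ ⊆S F))
            (λ eq → ∉Y eq ∘ ⊆S F) (λ eq → ∉Z eq ∘ ⊆S F) F

        chain-assemble : ChainOn L (full S) (suc j) (assemble α β γ δ ζ)
        chain-assemble (none σ)   σ∉ = refl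
        chain-assemble (𝕪∪ σ)     σ∉ = refl
        chain-assemble (𝕒∪ σ)     σ∉ = α-on σ λ (F , eq) →
          σ∉ (new ind-a (λ u∈ → u∈) (λ ()) (λ ()) F , ≡.cong suc eq)
        chain-assemble (𝕓∪ σ)     σ∉ = β-on σ λ (F , eq) →
          σ∉ (new ind-b (λ u∈ → u∈) (λ ()) (λ ()) F , ≡.cong suc eq)
        chain-assemble (𝕫∪ σ)     σ∉ = refl
        chain-assemble (𝕪𝕓∪ σ)    σ∉ = γ-on σ λ (F , eq) →
          σ∉ (new ind-yb ∩⇒∈ (λ _ → ∩∁⇒∉) (λ ()) F , ≡.cong suc eq)
        chain-assemble (𝕪𝕫∪ σ)    σ∉ = δ-on σ λ (F , eq) →
          σ∉ (new ind-yz R⊆S (λ _ → ∩∁⇒∉ ∘ R⊆R-Y) (λ _ → ∩∁⇒∉ ∘ R⊆R-Z) F , ≡.cong suc eq)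
        chain-assemble (𝕒𝕫∪ σ)    σ∉ = ζ-on σ λ (F , eq) →
          σ∉ (new ind-az ∩⇒∈ (λ ()) (λ _ → ∩∁⇒∉) F , ≡.cong suc eq)
        chain-assemble (𝕪𝕒 s t σ) σ∉ = refl
        chain-assemble (𝕒𝕓 t σ)   σ∉ = refl
        chain-assemble (𝕪𝕓𝕫 σ)    σ∉ = refl
        chain-assemble (𝕓𝕫 σ)     σ∉ = refl

      -- Up to sign φ is a chain map of degree -1; it realises the homotopy
      -- equivalence between Ind L and the suspension of Ind G.
      φ : Chain (suc (suc (suc (suc n)))) → Chain n
      φ c = cone x (λ σ → c (𝕪𝕫∪ σ)) ∔ ((λ σ → c (𝕪∪ σ)) ∔ (λ σ → c (𝕓∪ σ)))

      φ-cong : ∀ {c e} → c ≋ e → φ c ≋ φ e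
      φ-cong c≋e σ =
        +-cong (cone-additive x .cong (λ ρ → c≋e (𝕪𝕫∪ ρ)) σ) (+-cong (c≋e (𝕪∪ σ)) (c≋e (𝕓∪ σ)))

      φ-vanishes : ∀ {c} → c ≋ 0̇ → φ c ≋ 0̇
      φ-vanishes {c} c≋0 σ = begin
        φ c σ               ≈⟨ +-cong (vanishes (cone-additive x) (λ ρ → c≋0 (𝕪𝕫∪ ρ)) σ)
                                      (+-cong (c≋0 (𝕪∪ σ)) (c≋0 (𝕓∪ σ))) ⟩
        0# + (0# + 0#)      ≈⟨ solve [] (∅₀ ⊕ (∅₀ ⊕ ∅₀)) ∅₀ ≡.refl ⟩
        0#                  ∎

      chain-φ : ∀ {j c} → ChainOn L (full S) (suc j) c → ChainOn G (S ⁺ x) j (φ c)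
      chain-φ {j} {c} c-on =
        chain-∔ (pre-cone x∈V (v∈S⁺v x S) (λ u∈R → S⊆S⁺x (R⊆S u∈R)) (lk-≁ G) on-𝕪𝕫)
                (chain-∔ (chain-mono (λ u∈ → S⊆S⁺x (proj₁ (x∈p∩q⁻ S (∁ Y) u∈))) on-𝕪)
                         (chain-mono S⊆S⁺x on-𝕓))
        where open Components c-on

      -- In `φ (∂ᴷ c)` the `𝕪𝕓` terms of the `𝕪` and `𝕓` components cancel, and the surviving `𝕪𝕫`
      -- term is the one from the Leibniz rule for `cone x`.
      ∂-φ : ∀ {c} → SupportedOn {Γ = L} (full S) c → ∂ᴷ (φ c) ≋ ∸ φ (∂ᴷ c)
      ∂-φ {c} c-on σ = begin
        ∂ᴷ (φ c) σ
          ≈⟨ trans (∂-additive .homo-+ _ _ σ) (+-cong (∂-cone x cyz σ) (∂-additive .homo-+ _ _ σ)) ⟩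
        (c (𝕪𝕫∪ σ) - cone x (∂ᴷ cyz) σ) + (∂ᴷ cy σ + ∂ᴷ cb σ)
          ≈⟨ solve (c (𝕪𝕫∪ σ) ∷ cone x (∂ᴷ cyz) σ ∷ ∂ᴷ cy σ ∷ ∂ᴷ cb σ ∷ c (𝕪𝕓∪ σ) ∷ [])
               ((v₀ ⊝ v₁) ⊕ (v₂ ⊕ v₃)) (⊝ (v₁ ⊕ (⊝ (v₄ ⊕ (v₀ ⊕ v₂)) ⊕ (v₄ ⊝ v₃)))) ≡.refl ⟩
        - (cone x (∂ᴷ cyz) σ + (- (c (𝕪𝕓∪ σ) + (c (𝕪𝕫∪ σ) + ∂ᴷ cy σ)) + (c (𝕪𝕓∪ σ) - ∂ᴷ cb σ)))
          ≈⟨ -‿cong (+-cong (cone-additive x .cong ∂-𝕪𝕫 σ) (+-cong (∂-𝕪 σ) (∂-𝕓 σ))) ⟨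
        - φ (∂ᴷ c) σ ∎
        where
        open Boundary c c-on
        cyz cy cb : Chain n
        cyz ρ = c (𝕪𝕫∪ ρ)
        cy ρ  = c (𝕪∪ ρ)
        cb ρ  = c (𝕓∪ ρ)

      -- With f = x g + h, the cycle of Ind L corresponding to f is
      -- (b - a) h + (yz - yb - az) g.
      nonzero-lozin : ∀ {j} → Nonzero G (S ⁺ x) j → Nonzero L (full S) (suc j)
      nonzero-lozin {j} (f , f-on , ∂f≋0 , f-nb) = ψf , ψf-on , cycle , nb
        where
        g h : Chain n
        g = D x f
        h = off x f

        g-on : PreChainOn G R j g
        g-on = pre-D f-on

        h-on : ChainOn G S j h
        h-on = ≡.subst (λ T → ChainOn G T j h) (⁺⁻-cancel x∉S) (chain-off f-on)

        ∂g : ∂ᴷ g ≋ 0̇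
        ∂g = ∂-D-cycle x ∂f≋0

        ∂h : ∂ᴷ h ≋ ∸ g
        ∂h = ∂-off-cycle x ∂f≋0

        ∂-g : ∂ᴷ (∸ g) ≋ 0̇
        ∂-g σ = trans (homo-neg ∂-additive g σ) (trans (-‿cong (∂g σ)) -0#≈0#)

        ∂-h : ∂ᴷ (∸ h) ≋ ∸ ∸ g
        ∂-h σ = trans (homo-neg ∂-additive h σ) (-‿cong (∂h σ))

        ψf : Chain (suc (suc (suc (suc n))))
        ψf = assemble (∸ h) h (∸ g) g (∸ g)

        ψf-on : ChainOn L (full S) (suc j) ψf
        ψf-on = chain-assemble (chain-neg h-on) h-on (pre-neg (pre-mono R⊆R-Y g-on)) g-on
                               (pre-neg (pre-mono R⊆R-Z g-on))

        ∂0 : ∂ᴷ {n} 0̇ ≋ 0̇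
        ∂0 = vanishes ∂-additive λ _ → refl

        cycle : ∂ᴷ ψf ≋ 0̇
        cycle = by-cases (∂-supported ψf-supp) (λ _ _ → refl)
          (λ σ → begin
            ∂ᴷ ψf (none σ)                               ≈⟨ ∂-none σ ⟩
            0# + (- h σ + (h σ + (0# + ∂ᴷ 0̇ σ)))         ≈⟨ +-congˡ (+-congˡ (+-congˡ (+-congˡ (∂0 σ)))) ⟩
            0# + (- h σ + (h σ + (0# + 0#)))
              ≈⟨ solve (h σ ∷ []) (∅₀ ⊕ (⊝ v₀ ⊕ (v₀ ⊕ (∅₀ ⊕ ∅₀)))) ∅₀ ≡.refl ⟩
            0#                                           ∎)
          (λ σ → begin
            ∂ᴷ ψf (𝕪∪ σ)                   ≈⟨ ∂-𝕪 σ ⟩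
            - (- g σ + (g σ + ∂ᴷ 0̇ σ))     ≈⟨ -‿cong (+-congˡ (+-congˡ (∂0 σ))) ⟩
            - (- g σ + (g σ + 0#))         ≈⟨ solve (g σ ∷ []) (⊝ (⊝ v₀ ⊕ (v₀ ⊕ ∅₀))) ∅₀ ≡.refl ⟩
            0#                             ∎)
          (λ σ → begin
            ∂ᴷ ψf (𝕒∪ σ)                   ≈⟨ ∂-𝕒 σ ⟩
            - (- g σ + ∂ᴷ (∸ h) σ)         ≈⟨ -‿cong (+-congˡ (∂-h σ)) ⟩
            - (- g σ - - g σ)              ≈⟨ solve (g σ ∷ []) (⊝ (⊝ v₀ ⊝ ⊝ v₀)) ∅₀ ≡.refl ⟩
            0#                             ∎)
          (λ σ → begin
            ∂ᴷ ψf (𝕓∪ σ)                   ≈⟨ ∂-𝕓 σ ⟩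
            - g σ - ∂ᴷ h σ                 ≈⟨ +-congˡ (-‿cong (∂h σ)) ⟩
            - g σ - - g σ                  ≈⟨ -‿inverseʳ _ ⟩
            0#                             ∎)
          (λ σ → begin
            ∂ᴷ ψf (𝕫∪ σ)                   ≈⟨ ∂-𝕫 σ ⟩
            g σ + (- g σ - ∂ᴷ 0̇ σ)         ≈⟨ +-congˡ (+-congˡ (-‿cong (∂0 σ))) ⟩
            g σ + (- g σ - 0#)             ≈⟨ solve (g σ ∷ []) (v₀ ⊕ (⊝ v₀ ⊝ ∅₀)) ∅₀ ≡.refl ⟩
            0#                             ∎)
          (λ σ → trans (∂-𝕪𝕓 σ) (∂-g σ))
          (λ σ → trans (∂-𝕪𝕫 σ) (∂g σ))
          (λ σ → trans (∂-𝕒𝕫 σ) (∂-g σ))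
          where
          ψf-supp = chain⇒supported ψf-on
          open Boundary ψf ψf-supp

        nb : ∀ e → ChainOn L (full S) (suc (suc j)) e → ¬ (∂ᴷ e ≋ ψf)
        -- The components of `ψf` give φ ψf = x g + h = f; the sign compensates for `φ`
        -- anticommuting with the boundary.
        nb e e-on ∂e≋ψf = f-nb (∸ φ e) (chain-neg (chain-φ e-on)) λ σ → begin
          ∂ᴷ (∸ φ e) σ                    ≈⟨ homo-neg ∂-additive _ σ ⟩
          - ∂ᴷ (φ e) σ                    ≈⟨ -‿cong (∂-φ (chain⇒supported e-on) σ) ⟩
          - - φ (∂ᴷ e) σ                  ≈⟨ -‿cong (-‿cong (φ-cong ∂e≋ψf σ)) ⟩
          - - (cone x g σ + (0# + h σ))
            ≈⟨ solve (_ ∷ _ ∷ []) (⊝ ⊝ (v₀ ⊕ (∅₀ ⊕ v₁))) (v₀ ⊕ v₁) ≡.refl ⟩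
          cone x g σ + h σ                ≈⟨ cone-D x f σ ⟨
          f σ                             ∎

      -- If φ c = ∂ (x g + h) then c is the boundary of
      -- a (c∅ + h) - b h + yb (g - cy) - yz g + az (cz + g).
      lozin-nonzero : ∀ {j} → Nonzero L (full S) (suc j) → Nonzero G (S ⁺ x) j
      lozin-nonzero {j} (c , c-on , ∂c≋0 , c-nb) =
        φ c , chain-φ c-on
        , (λ σ → trans (∂-φ c-supp σ) (trans (-‿cong (φ-vanishes ∂c≋0 σ)) -0#≈0#)) , nb
        where
        open Components c-on

        c-supp : SupportedOn {Γ = L} (full S) c
        c-supp = chain⇒supported c-on

        c∅ cy ca cb cz cyz : Chain n
        c∅ ρ  = c (none ρ)
        cy ρ  = c (𝕪∪ ρ)
        ca ρ  = c (𝕒∪ ρ)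
        cb ρ  = c (𝕓∪ ρ)
        cz ρ  = c (𝕫∪ ρ)
        cyz ρ = c (𝕪𝕫∪ ρ)

        nb : ∀ d → ChainOn G (S ⁺ x) (suc j) d → ¬ (∂ᴷ d ≋ φ c)
        nb d d-on ∂d≋φc = c-nb e e-on (by-cases (∂-supported e-supp) c-supp
          (λ σ → begin
            ∂ᴷ e (none σ)
              ≈⟨ E.∂-none σ ⟩
            0# + (c∅ σ + h σ + (- h σ + (0# + ∂ᴷ 0̇ σ)))
              ≈⟨ +-congˡ (+-congˡ (+-congˡ (+-congˡ (∂0 σ)))) ⟩
            0# + (c∅ σ + h σ + (- h σ + (0# + 0#)))
              ≈⟨ solve (c∅ σ ∷ h σ ∷ []) (∅₀ ⊕ (v₀ ⊕ v₁ ⊕ (⊝ v₁ ⊕ (∅₀ ⊕ ∅₀)))) v₀ ≡.refl ⟩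
            c∅ σ ∎)
          (λ σ → begin
            ∂ᴷ e (𝕪∪ σ)                            ≈⟨ E.∂-𝕪 σ ⟩
            - (g σ - cy σ + (- g σ + ∂ᴷ 0̇ σ))      ≈⟨ -‿cong (+-congˡ (+-congˡ (∂0 σ))) ⟩
            - (g σ - cy σ + (- g σ + 0#))
              ≈⟨ solve (g σ ∷ cy σ ∷ []) (⊝ (v₀ ⊝ v₁ ⊕ (⊝ v₀ ⊕ ∅₀))) v₁ ≡.refl ⟩
            cy σ ∎)
          -- No component of `e` involves `ca`; it is recovered from ∂c = 0 over the empty path set.
          -- The `𝕪𝕓` and `𝕒𝕫` components are recovered likewise from ∂c = 0 over `𝕪` and `𝕫`.
          (λ σ → begin
            ∂ᴷ e (𝕒∪ σ)
              ≈⟨ E.∂-𝕒 σ ⟩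
            - (cz σ + g σ + ∂ᴷ (c∅ ∔ h) σ)
              ≈⟨ -‿cong (+-congˡ (trans (∂-additive .homo-+ _ _ σ) (+-congˡ (∂h σ)))) ⟩
            - (cz σ + g σ + (∂ᴷ c∅ σ + (cy σ + cb σ - g σ)))
              ≈⟨ solve (cz σ ∷ g σ ∷ ∂ᴷ c∅ σ ∷ cy σ ∷ cb σ ∷ ca σ ∷ [])
                   (⊝ (v₀ ⊕ v₁ ⊕ (v₂ ⊕ (v₃ ⊕ v₄ ⊝ v₁)))) (v₅ ⊝ (v₃ ⊕ (v₅ ⊕ (v₄ ⊕ (v₀ ⊕ v₂))))) ≡.refl ⟩
            ca σ - (cy σ + (ca σ + (cb σ + (cz σ + ∂ᴷ c∅ σ))))
              ≈⟨ +-congˡ (-‿cong (trans (sym (C.∂-none σ)) (∂c≋0 _))) ⟩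
            ca σ - 0#
              ≈⟨ solve (ca σ ∷ []) (v₀ ⊝ ∅₀) v₀ ≡.refl ⟩
            ca σ ∎)
          (λ σ → begin
            ∂ᴷ e (𝕓∪ σ)
              ≈⟨ E.∂-𝕓 σ ⟩
            g σ - cy σ - ∂ᴷ (∸ h) σ
              ≈⟨ +-congˡ (-‿cong (trans (homo-neg ∂-additive h σ) (-‿cong (∂h σ)))) ⟩
            g σ - cy σ - - (cy σ + cb σ - g σ)
              ≈⟨ solve (g σ ∷ cy σ ∷ cb σ ∷ []) (v₀ ⊝ v₁ ⊝ ⊝ (v₁ ⊕ v₂ ⊝ v₀)) v₂ ≡.refl ⟩
            cb σ ∎)
          (λ σ → begin
            ∂ᴷ e (𝕫∪ σ)                            ≈⟨ E.∂-𝕫 σ ⟩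
            - g σ + (cz σ + g σ - ∂ᴷ 0̇ σ)          ≈⟨ +-congˡ (+-congˡ (-‿cong (∂0 σ))) ⟩
            - g σ + (cz σ + g σ - 0#)
              ≈⟨ solve (g σ ∷ cz σ ∷ []) (⊝ v₀ ⊕ (v₁ ⊕ v₀ ⊝ ∅₀)) v₁ ≡.refl ⟩
            cz σ ∎)
          (λ σ → begin
            ∂ᴷ e (𝕪𝕓∪ σ)
              ≈⟨ E.∂-𝕪𝕓 σ ⟩
            ∂ᴷ (g ∸ cy) σ
              ≈⟨ trans (homo-− ∂-additive _ _ σ) (+-congʳ (∂g σ)) ⟩
            - cyz σ - ∂ᴷ cy σ
              ≈⟨ solve (cyz σ ∷ ∂ᴷ cy σ ∷ c (𝕪𝕓∪ σ) ∷ []) (⊝ v₀ ⊝ v₁) (v₂ ⊕ ⊝ (v₂ ⊕ (v₀ ⊕ v₁))) ≡.refl ⟩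
            c (𝕪𝕓∪ σ) - (c (𝕪𝕓∪ σ) + (cyz σ + ∂ᴷ cy σ))
              ≈⟨ +-congˡ (trans (sym (C.∂-𝕪 σ)) (∂c≋0 _)) ⟩
            c (𝕪𝕓∪ σ) + 0#
              ≈⟨ +-identityʳ _ ⟩
            c (𝕪𝕓∪ σ) ∎)
          (λ σ → begin
            ∂ᴷ e (𝕪𝕫∪ σ)     ≈⟨ E.∂-𝕪𝕫 σ ⟩
            ∂ᴷ (∸ g) σ       ≈⟨ trans (homo-neg ∂-additive _ σ) (-‿cong (∂g σ)) ⟩
            - - cyz σ        ≈⟨ solve (cyz σ ∷ []) (⊝ ⊝ v₀) v₀ ≡.refl ⟩
            cyz σ            ∎)
          (λ σ → begin
            ∂ᴷ e (𝕒𝕫∪ σ)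
              ≈⟨ E.∂-𝕒𝕫 σ ⟩
            ∂ᴷ (cz ∔ g) σ
              ≈⟨ trans (∂-additive .homo-+ _ _ σ) (+-congˡ (∂g σ)) ⟩
            ∂ᴷ cz σ - cyz σ
              ≈⟨ solve (∂ᴷ cz σ ∷ cyz σ ∷ c (𝕒𝕫∪ σ) ∷ []) (v₀ ⊝ v₁) (v₂ ⊝ (v₁ ⊕ (v₂ ⊝ v₀))) ≡.refl ⟩
            c (𝕒𝕫∪ σ) - (cyz σ + (c (𝕒𝕫∪ σ) - ∂ᴷ cz σ))
              ≈⟨ +-congˡ (-‿cong (trans (sym (C.∂-𝕫 σ)) (∂c≋0 _))) ⟩
            c (𝕒𝕫∪ σ) - 0#
              ≈⟨ solve (c (𝕒𝕫∪ σ) ∷ []) (v₀ ⊝ ∅₀) v₀ ≡.refl ⟩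
            c (𝕒𝕫∪ σ) ∎))
          where
          g h : Chain n
          g = D x d
          h = off x d

          rest : Chain n
          rest = cy ∔ cb

          -- In φ c = x `cyz` + `rest` neither `cyz` nor `rest` involves `x`. Splitting ∂d = φ c at
          -- `x` therefore determines ∂g and ∂h.
          D-rest : D x rest ≋ 0̇
          D-rest = D≋0 x∉S (chain-∔ (chain-mono (λ u∈ → proj₁ (x∈p∩q⁻ S (∁ Y) u∈)) on-𝕪) on-𝕓)

          D-cyz : D x cyz ≋ 0̇
          D-cyz τ = D-support x λ _ → on-𝕪𝕫 _ λ (F , _) → x∉S (R⊆S (⊆S F (v∈S⁺v x τ)))

          cone-cone : cone x (cone x cyz) ≋ 0̇
          cone-cone σ = cone-support x λ _ → cone-support x λ x∈ → ⊥-elim (v∉S⁻v x σ x∈)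

          ∂g : ∂ᴷ g ≋ ∸ cyz
          ∂g σ = begin
            ∂ᴷ g σ                         ≈⟨ ∂-D x d σ ⟩
            - D x (∂ᴷ d) σ                 ≈⟨ -‿cong (D-additive x .cong ∂d≋φc σ) ⟩
            - D x (cone x cyz ∔ rest) σ    ≈⟨ -‿cong (D-additive x .homo-+ _ _ σ) ⟩
            - (off x cyz σ + D x rest σ)   ≈⟨ -‿cong (+-cong (off-id x D-cyz σ) (D-rest σ)) ⟩
            - (cyz σ + 0#)                 ≈⟨ -‿cong (+-identityʳ _) ⟩
            - cyz σ                        ∎

          ∂h : ∂ᴷ h ≋ cy ∔ cb ∸ g
          ∂h σ = begin
            ∂ᴷ h σ
              ≈⟨ ∂-off x d σ ⟩
            off x (∂ᴷ d) σ - g σ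
              ≈⟨ +-congʳ (D-additive x .cong (λ ρ → trans (cone-additive x .cong ∂d≋φc ρ)
                                                    (cone-additive x .homo-+ _ _ ρ)) σ) ⟩
            D x (cone x (cone x cyz) ∔ cone x rest) σ - g σ
              ≈⟨ +-congʳ (trans (D-additive x .homo-+ _ _ σ)
                           (+-cong (vanishes (D-additive x) cone-cone σ) (off-id x D-rest σ))) ⟩
            0# + (cy σ + cb σ) - g σ
              ≈⟨ +-congʳ (+-identityˡ _) ⟩
            cy σ + cb σ - g σ ∎

          g-on : ChainOn G R j g
          g-on = chain-D d-on

          h-on : ChainOn G S (suc j) h
          h-on = ≡.subst (λ T → ChainOn G T (suc j) h) (⁺⁻-cancel x∉S) (chain-off d-on)

          e : Chain (suc (suc (suc (suc n))))
          e = assemble (c∅ ∔ h) (∸ h) (g ∸ cy) (∸ g) (cz ∔ g)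

          e-on : ChainOn L (full S) (suc (suc j)) e
          e-on = chain-assemble (chain-∔ on-none h-on) (chain-neg h-on)
            (chain⇒pre (chain-∔ (chain-mono R⊆R-Y g-on) (chain-neg on-𝕪)))
            (chain⇒pre (chain-neg g-on))
            (chain⇒pre (chain-∔ on-𝕫 (chain-mono R⊆R-Z g-on)))

          e-supp : SupportedOn {Γ = L} (full S) e
          e-supp = chain⇒supported e-on

          ∂0 : ∂ᴷ {n} 0̇ ≋ 0̇
          ∂0 = vanishes ∂-additive λ _ → refl

          module E = Boundary e e-supp
          module C = Boundary c c-supp

  -- Regularity bounds

  -- The regularity of the subgraph induced on `T` is at most `k`, with no claim that the maximum
  -- exists.
  Bounded : Graph n → Subset n → ℕ → Set (c ⊔ ℓ)
  Bounded Γ T k = ∀ {S j} → S ⊆ T → Nonzero Γ S j → j ≤ k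

  module _ {Γ : Graph n} where
    open Graph Γ using (_~_)

    bounded-⊆ : ∀ {T T′ k} → T ⊆ T′ → Bounded Γ T′ k → Bounded Γ T k
    bounded-⊆ T⊆T′ bound S⊆T = bound (T⊆T′ ∘ S⊆T)

    bounded-suc : ∀ {T k} → Bounded Γ T k → Bounded Γ T (suc k)
    bounded-suc bound S⊆T nz = m≤n⇒m≤1+n (bound S⊆T nz)

    bounded-vertex : ∀ {v T k} → v ∈ V Γ → Bounded Γ (T ⁻ v) (suc k) → Bounded Γ (lk Γ T v) k →
                     Bounded Γ T (suc k)
    bounded-vertex {v} v∈V bound⁻ bound-lk {S} {j} S⊆T nz with v ∈? S
    ... | no v∉S = bound⁻ (⊆⇒⊆⁻ S⊆T v∉S) nz
    bounded-vertex v∈V bound⁻ bound-lk {S} {zero} S⊆T nz | yes v∈S = z≤n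
    bounded-vertex {v} {T} {k} v∈V bound⁻ bound-lk {S} {suc j} S⊆T nz | yes v∈S with suc j ≤? suc k
    ... | yes j≤k = j≤k
    -- Whether `S ⁻ v` has homology cannot be decided, but in this range of degrees `bound⁻` refutes
    -- it, and the class passes to the link.
    ... | no  j≰k = s≤s (bound-lk lkS⊆lkT (nonzero-link v∈V v∈S nz λ nz⁻ →
                      j≰k (bound⁻ (λ u∈ → ∈⇒∈⁻ (S⊆T (∈⁻⇒∈ u∈)) (∈⁻⇒≢ u∈)) nz⁻)))
      where
      lkS⊆lkT : lk Γ S v ⊆ lk Γ T v
      lkS⊆lkT u∈ = ∈lk Γ (S⊆T (lk⊆ Γ u∈)) (lk-≢ Γ u∈) (lk-≁ Γ u∈)

    bounded-isolated : ∀ {v T k} → v ∈ V Γ → (∀ {u} → u ∈ T → ¬ (v ~ u)) → Bounded Γ (T ⁻ v) k →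
                       Bounded Γ T k
    bounded-isolated {v} v∈V v≁T bound {S} S⊆T nz with v ∈? S
    ... | no  v∉S = bound (⊆⇒⊆⁻ S⊆T v∉S) nz
    ... | yes v∈S = ⊥-elim (zero-isolated v∈V v∈S (v≁T ∘ S⊆T) nz)

  module LozinBounds {n : ℕ} (G : Graph n) (x : Fin n) (x∈V : x ∈ V G)
                     (Y Z : Subset n) (N≡Y∪Z : N G x ≡ Y ∪ Z) where
    open LozinGraph G x x∈V Y Z N≡Y∪Z
    open LozinHomology G x x∈V Y Z N≡Y∪Z

    private
      𝕪∈ : 𝕪 ∈ V L
      𝕪∈ = here
      𝕒∈ : 𝕒 ∈ V L
      𝕒∈ = there here
      𝕓∈ : 𝕓 ∈ V L
      𝕓∈ = there (there here)
      𝕫∈ : 𝕫 ∈ V L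
      𝕫∈ = there (there (there here))

    -- Induced subgraphs of ℒ(G) without `𝕪` or without `𝕫`

    module _ {W : Subset n} {k : ℕ} (x∉W : x ∉ W) (bound : Bounded G W k) where

      bounded-none : Bounded L (none W) k
      bounded-none {none S} S⊆ nz =
        bound (λ u∈S → case S⊆ (lift u∈S) of λ { (lift u∈W) → u∈W })
              (nonzero-restrict (λ x∈S → x∉W (case S⊆ (lift x∈S) of λ { (lift x∈W) → x∈W })) nz)
      bounded-none {inside ∷ _} S⊆ nz = case S⊆ here of λ ()
      bounded-none {outside ∷ inside ∷ _} S⊆ nz = case S⊆ (there here) of λ { (there ()) }
      bounded-none {outside ∷ outside ∷ inside ∷ _} S⊆ nz =
        case S⊆ (there (there here)) of λ { (there (there ())) }
      bounded-none {outside ∷ outside ∷ outside ∷ inside ∷ _} S⊆ nz =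
        case S⊆ (there (there (there here))) of λ { (there (there (there ()))) }

      bounded-𝕪 : Bounded L (𝕪∪ W) (suc k)
      bounded-𝕪 = bounded-vertex {v = 𝕪} 𝕪∈ (bounded-suc bounded-none) (bounded-⊆ ∈lk⇒∈⁻ bounded-none)

      bounded-𝕫 : Bounded L (𝕫∪ W) (suc k)
      bounded-𝕫 = bounded-vertex {v = 𝕫} 𝕫∈ (bounded-suc bounded-none) (bounded-⊆ ∈lk⇒∈⁻ bounded-none)

      bounded-𝕒𝕫 : Bounded L (𝕒𝕫∪ W) (suc k)
      bounded-𝕒𝕫 = bounded-isolated {v = 𝕒} 𝕒∈ (λ where
        (there here)                 (fwd ())
        (there here)                 (bwd ())
        (there (there (there here))) (fwd ())
        (there (there (there here))) (bwd ())
        (lift _)                     (fwd ())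
        (lift _)                     (bwd ())) bounded-𝕫

      bounded-𝕪𝕓 : Bounded L (𝕪𝕓∪ W) (suc k)
      bounded-𝕪𝕓 = bounded-isolated {v = 𝕓} 𝕓∈ (λ where
        here                 (fwd ())
        here                 (bwd ())
        (there (there here)) (fwd ())
        (there (there here)) (bwd ())
        (lift _)             (fwd ())
        (lift _)             (bwd ())) bounded-𝕪

      -- Deleting `𝕓` isolates `𝕒`, while linking `𝕓` removes both `𝕒` and `𝕫` and leaves only old
      -- vertices.
      bounded-𝕒𝕓𝕫 : Bounded L (outside ∷ inside ∷ inside ∷ inside ∷ W) (suc k)
      bounded-𝕒𝕓𝕫 = bounded-vertex {v = 𝕓} 𝕓∈ bounded-𝕒𝕫 (bounded-⊆ lk⊆W bounded-none)
        where
        lk⊆W : lk L (outside ∷ inside ∷ inside ∷ inside ∷ W) 𝕓 ⊆ none W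
        lk⊆W u∈ with lk⊆ L u∈
        ... | there here                 = ⊥-elim (lk-≁ L u∈ (bwd ab))
        ... | there (there here)         = ⊥-elim (lk-≢ L u∈ ≡.refl)
        ... | there (there (there here)) = ⊥-elim (lk-≁ L u∈ (fwd bz))
        ... | lift u∈W                   = lift u∈W

      bounded-𝕪𝕒𝕓 : Bounded L (inside ∷ inside ∷ inside ∷ outside ∷ W) (suc k)
      bounded-𝕪𝕒𝕓 = bounded-vertex {v = 𝕒} 𝕒∈ bounded-𝕪𝕓 (bounded-⊆ lk⊆W bounded-none)
        where
        lk⊆W : lk L (inside ∷ inside ∷ inside ∷ outside ∷ W) 𝕒 ⊆ none W
        lk⊆W u∈ with lk⊆ L u∈
        ... | here               = ⊥-elim (lk-≁ L u∈ (bwd ya))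
        ... | there here         = ⊥-elim (lk-≢ L u∈ ≡.refl)
        ... | there (there here) = ⊥-elim (lk-≁ L u∈ (fwd ab))
        ... | lift u∈W           = lift u∈W

    -- The bound reg ℒ(G) ≤ 1 + reg G

    module _ {T : Subset n} {k : ℕ} (x∈T : x ∈ T) (bound : Bounded G T k) where

      private
        bound⁻ : Bounded G (T ⁻ x) k
        bound⁻ = bounded-⊆ ∈⁻⇒∈ bound

        x∉T⁻ : x ∉ T ⁻ x
        x∉T⁻ = v∉S⁻v x T

        old-⊆ : ∀ {s₀ s₁ s₂ s₃ t₀ t₁ t₂ t₃} {S S′ : Subset n} →
                s₀ ∷ s₁ ∷ s₂ ∷ s₃ ∷ S ⊆ t₀ ∷ t₁ ∷ t₂ ∷ t₃ ∷ S′ → S ⊆ S′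
        old-⊆ S⊆ u∈S = case S⊆ (lift u∈S) of λ { (lift u∈S′) → u∈S′ }

        bounded-full′ : ∀ {S j} → S ⊆ T ⁻ x → Nonzero L (full S) j → j ≤ suc k
        bounded-full′ {S} {zero}  S⊆ nz = z≤n
        bounded-full′ {S} {suc j} S⊆ nz = s≤s (bound S⁺x⊆T (lozin-nonzero (x∉T⁻ ∘ S⊆) nz))
          where
          S⁺x⊆T : S ⁺ x ⊆ T
          S⁺x⊆T u∈ with ∈⁺⇒≡∨∈ u∈
          ... | inj₁ ≡.refl = x∈T
          ... | inj₂ u∈S    = ∈⁻⇒∈ (S⊆ u∈S)

        -- Inserting a missing `𝕓` preserves the class unless its link has homology in degree `j`.
        -- That link has `𝕪` as its only possible new vertex, so `bounded-𝕪` excludes this once `j`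
        -- exceeds `suc k`.
        with-𝕓 : ∀ {s j S} → S ⊆ T ⁻ x → Nonzero L (inside ∷ inside ∷ s ∷ inside ∷ S) j → j ≤ suc k
        with-𝕓 {inside}          S⊆ nz = bounded-full′ S⊆ nz
        with-𝕓 {outside} {j} {S} S⊆ nz with j ≤? suc k
        ... | yes j≤ = j≤
        ... | no  j≰ = bounded-full′ S⊆ (nonzero-insert {v = 𝕓} nz (j≰ ∘ bounded-𝕪 x∉T⁻ bound⁻ lk⊆W))
          where
          lk⊆W : lk L (full S) 𝕓 ⊆ 𝕪∪ (T ⁻ x)
          lk⊆W u∈ with lk⊆ L u∈
          ... | here                       = here
          ... | there here                 = ⊥-elim (lk-≁ L u∈ (bwd ab))
          ... | there (there here)         = ⊥-elim (lk-≢ L u∈ ≡.refl)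
          ... | there (there (there here)) = ⊥-elim (lk-≁ L u∈ (fwd bz))
          ... | lift u∈S                   = lift (S⊆ u∈S)

        with-𝕒 : ∀ {r s j S} → S ⊆ T ⁻ x → Nonzero L (inside ∷ r ∷ s ∷ inside ∷ S) j → j ≤ suc k
        with-𝕒 {inside}              S⊆ nz = with-𝕓 S⊆ nz
        with-𝕒 {outside} {s} {j} {S} S⊆ nz with j ≤? suc k
        ... | yes j≤ = j≤
        ... | no  j≰ = with-𝕓 S⊆ (nonzero-insert {v = 𝕒} nz (j≰ ∘ bounded-𝕫 x∉T⁻ bound⁻ lk⊆W))
          where
          lk⊆W : lk L (inside ∷ inside ∷ s ∷ inside ∷ S) 𝕒 ⊆ 𝕫∪ (T ⁻ x)
          lk⊆W u∈ with lk⊆ L u∈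
          ... | here                       = ⊥-elim (lk-≁ L u∈ (bwd ya))
          ... | there here                 = ⊥-elim (lk-≢ L u∈ ≡.refl)
          ... | there (there here)         = ⊥-elim (lk-≁ L u∈ (fwd ab))
          ... | there (there (there here)) = there (there (there here))
          ... | lift u∈S                   = lift (S⊆ u∈S)

      bounded-full : Bounded L (full (T ⁻ x)) (suc k)
      bounded-full {outside ∷ s₁ ∷ s₂ ∷ s₃ ∷ S} S⊆ nz = bounded-𝕒𝕓𝕫 x∉T⁻ bound⁻ (λ where
        (there here)                 → there here
        (there (there here))         → there (there here)
        (there (there (there here))) → there (there (there here))
        (lift u∈S)                   → lift (old-⊆ S⊆ u∈S)) nz
      bounded-full {inside ∷ s₁ ∷ s₂ ∷ outside ∷ S} S⊆ nz = bounded-𝕪𝕒𝕓 x∉T⁻ bound⁻ (λ where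
        here                 → here
        (there here)         → there here
        (there (there here)) → there (there here)
        (lift u∈S)           → lift (old-⊆ S⊆ u∈S)) nz
      bounded-full {inside ∷ s₁ ∷ s₂ ∷ inside ∷ S} S⊆ nz = with-𝕒 (old-⊆ S⊆) nz

    -- Joining the edge 𝕓𝕫 (or 𝕪𝕒) to the link of 𝕫 (or 𝕪) gives a subgraph of ℒ(G ∖ u).
    module _ {u : Fin n} {k : ℕ} (x≢u : x ≢ u) (bound : Bounded G (V G ⁻ u) k) where

      private
        W : Subset n
        W = V G ⁻ x

        bounded-full⁻ : Bounded L (full (V G ⁻ u ⁻ x)) (suc k)
        bounded-full⁻ = bounded-full (∈⇒∈⁻ x∈V x≢u) bound

        avoid : ∀ {w} → w ∈ W → w ≢ u → w ∈ V G ⁻ u ⁻ x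
        avoid w∈W w≢u = ∈⇒∈⁻ (∈⇒∈⁻ (∈⁻⇒∈ w∈W) w≢u) (∈⁻⇒≢ w∈W)

      bounded-lk-𝕫 : u ∈ Z → Bounded L (lk L (inside ∷ outside ∷ inside ∷ inside ∷ W) 𝕫) k
      bounded-lk-𝕫 u∈Z {s₀ ∷ s₁ ∷ s₂ ∷ s₃ ∷ S} {j} S⊆ nz = ≤-pred (bounded-full⁻ ⊆full⁻
        (nonzero-edge {p = 𝕓} {q = 𝕫} (fwd bz) 𝕓∉ 𝕫∉ (𝕓≁ ∘ S⊆) (λ w∈ → lk-≁ L (S⊆ w∈)) nz))
        where
        R : Subset (suc (suc (suc (suc n))))
        R = lk L (inside ∷ outside ∷ inside ∷ inside ∷ W) 𝕫

        𝕓∉ : 𝕓 ∉ s₀ ∷ s₁ ∷ s₂ ∷ s₃ ∷ S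
        𝕓∉ 𝕓∈S = lk-≁ L (S⊆ 𝕓∈S) (bwd bz)

        𝕫∉ : 𝕫 ∉ s₀ ∷ s₁ ∷ s₂ ∷ s₃ ∷ S
        𝕫∉ 𝕫∈S = lk-≢ L (S⊆ 𝕫∈S) ≡.refl

        𝕓≁ : ∀ {w} → w ∈ R → ¬ (Graph._~_ L 𝕓 w)
        𝕓≁ w∈R (fwd bz) = lk-≢ L w∈R ≡.refl
        𝕓≁ w∈R (bwd ab) = case lk⊆ L w∈R of λ { (there ()) }

        -- As `u ∈ Z`, the link of `𝕫` misses `old u`, and the enlarged set falls under the bound
        -- obtained from G - u.
        ⊆full⁻ : s₀ ∷ s₁ ∷ inside ∷ inside ∷ S ⊆ full (V G ⁻ u ⁻ x)
        ⊆full⁻ = ⊆full λ w∈S → case lk⊆ L (S⊆ (lift w∈S)) of λ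
          { (lift w∈W) → avoid w∈W λ { ≡.refl → lk-≁ L (S⊆ (lift w∈S)) (fwd (zZ u∈Z)) } }

      bounded-lk-𝕪 : u ∈ Y → Bounded L (lk L (inside ∷ inside ∷ outside ∷ inside ∷ W) 𝕪) k
      bounded-lk-𝕪 u∈Y {s₀ ∷ s₁ ∷ s₂ ∷ s₃ ∷ S} {j} S⊆ nz = ≤-pred (bounded-full⁻ ⊆full⁻
        (nonzero-edge {p = 𝕪} {q = 𝕒} (fwd ya) 𝕪∉ 𝕒∉ (λ w∈ → lk-≁ L (S⊆ w∈)) (𝕒≁ ∘ S⊆) nz))
        where
        R : Subset (suc (suc (suc (suc n))))
        R = lk L (inside ∷ inside ∷ outside ∷ inside ∷ W) 𝕪

        𝕒∉ : 𝕒 ∉ s₀ ∷ s₁ ∷ s₂ ∷ s₃ ∷ S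
        𝕒∉ 𝕒∈S = lk-≁ L (S⊆ 𝕒∈S) (fwd ya)

        𝕪∉ : 𝕪 ∉ s₀ ∷ s₁ ∷ s₂ ∷ s₃ ∷ S
        𝕪∉ 𝕪∈S = lk-≢ L (S⊆ 𝕪∈S) ≡.refl

        𝕒≁ : ∀ {w} → w ∈ R → ¬ (Graph._~_ L 𝕒 w)
        𝕒≁ w∈R (bwd ya) = lk-≢ L w∈R ≡.refl
        𝕒≁ w∈R (fwd ab) = case lk⊆ L w∈R of λ { (there (there ())) }

        ⊆full⁻ : inside ∷ inside ∷ s₂ ∷ s₃ ∷ S ⊆ full (V G ⁻ u ⁻ x)
        ⊆full⁻ = ⊆full λ w∈S → case lk⊆ L (S⊆ (lift w∈S)) of λ
          { (lift w∈W) → avoid w∈W λ { ≡.refl → lk-≁ L (S⊆ (lift w∈S)) (fwd (yY u∈Y)) } }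

  -- Regularity in terms of nonzero homology

  private
    module _ {Γ : Graph n} where
      open Graph Γ using (_~_)

      ind⇒face : ∀ {S σ} → Ind (Γ [ S ]) σ → Face Γ S σ
      ind⇒face {S} (σ⊆ , ind) = face (λ u∈ → proj₁ (split u∈)) (λ u∈ → proj₂ (split u∈))
        λ u∈ v∈ u~v → ind u∈ v∈ (u~v , proj₂ (split u∈) , proj₂ (split v∈))
        where
        split : ∀ {u} → u ∈ _ → u ∈ V Γ × u ∈ S
        split u∈σ = x∈p∩q⁻ (V Γ) S (σ⊆ u∈σ)

      face⇒ind : ∀ {S σ} → Face Γ S σ → Ind (Γ [ S ]) σ
      face⇒ind F = (λ u∈ → x∈p∩q⁺ (⊆V F u∈ , ⊆S F u∈)) , λ u∈ v∈ (u~v , _) → independent F u∈ v∈ u~v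

      face-∖⁻ : ∀ {v S σ} → Face (Γ ∖ v) S σ → Face Γ S σ
      face-∖⁻ {v} F = face (∈V∖⇒∈V Γ ∘ ⊆V F) (⊆S F) λ u∈ w∈ u~w →
        independent F u∈ w∈ (u~w , proj₂ (x∈p∩q⁻ (V Γ) _ (⊆V F u∈)) , proj₂ (x∈p∩q⁻ (V Γ) _ (⊆V F w∈)))

      face-∖⁺ : ∀ {v S σ} → S ⊆ V (Γ ∖ v) → Face Γ S σ → Face (Γ ∖ v) S σ
      face-∖⁺ S⊆ F = face (S⊆ ∘ ⊆S F) (⊆S F) λ u∈ w∈ (u~w , _) → independent F u∈ w∈ u~w

      -- The complex is a parameter so that the homology of `Γ` and that of `Γ ∖ v` are both
      -- expressed by faces of `Γ`.
      H̃⇒nonzero : ∀ {Δ S j} → (∀ {σ} → Δ σ → Face Γ S σ) → (∀ {σ} → Face Γ S σ → Δ σ) →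
                   H̃≢0 𝕜 Δ j → Nonzero Γ S j
      H̃⇒nonzero to from (f , (f-on , ∂f≈0) , f-nb) =
        f , (λ σ σ∉ → f-on σ λ (d , e) → σ∉ (to d , e))
        , (λ τ → trans (reflexive (∂ᴷ≡∂ f τ)) (∂f≈0 τ))
        , λ g g-on ∂g≋f → f-nb (g , (λ σ σ∉ → g-on σ λ (F , e) → σ∉ (from F , e))
                                  , λ τ → trans (reflexive (≡.sym (∂ᴷ≡∂ g τ))) (∂g≋f τ))

      nonzero⇒H̃ : ∀ {Δ S j} → (∀ {σ} → Δ σ → Face Γ S σ) → (∀ {σ} → Face Γ S σ → Δ σ) →
                   Nonzero Γ S j → H̃≢0 𝕜 Δ j
      nonzero⇒H̃ to from (f , f-on , ∂f≋0 , f-nb) =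
        f , ((λ σ σ∉ → f-on σ λ (F , e) → σ∉ (from F , e))
            , λ τ → trans (reflexive (≡.sym (∂ᴷ≡∂ f τ))) (∂f≋0 τ))
        , λ (g , g-on , ∂g≈f) → f-nb g (λ σ σ∉ → g-on σ λ (d , e) → σ∉ (to d , e))
                                       (λ τ → trans (reflexive (∂ᴷ≡∂ g τ)) (∂g≈f τ))

  HasReg : Graph n → ℕ → Set (c ⊔ ℓ)
  HasReg Γ r = reg_≐_ 𝕜 Γ r

  module _ {Γ : Graph n} where

    reg⇒bounded : ∀ {r} → HasReg Γ r → Bounded Γ (V Γ) r
    reg⇒bounded (_ , max) S⊆V nz = max _ (_ , S⊆V , nonzero⇒H̃ ind⇒face face⇒ind nz)

    reg⇒nonzero : ∀ {r} → HasReg Γ r → ∃[ S ] S ⊆ V Γ × Nonzero Γ S r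
    reg⇒nonzero ((S , S⊆V , H) , _) = S , S⊆V , H̃⇒nonzero ind⇒face face⇒ind H

    bounded⇒reg : ∀ {S r} → S ⊆ V Γ → Nonzero Γ S r → Bounded Γ (V Γ) r → HasReg Γ r
    bounded⇒reg S⊆V nz bound =
      (_ , S⊆V , nonzero⇒H̃ ind⇒face face⇒ind nz) , λ j (S , S⊆ , H) →
      bound S⊆ (H̃⇒nonzero ind⇒face face⇒ind H)

    private
      ⊆V∖ : ∀ {v} {S : Subset n} → S ⊆ V Γ ⁻ v → S ⊆ V (Γ ∖ v)
      ⊆V∖ S⊆ = ≡.subst (_ ∈_) (≡.sym (V∖≡V⁻ Γ)) ∘ S⊆

    reg∖⇒bounded : ∀ {v s} → HasReg (Γ ∖ v) s → Bounded Γ (V Γ ⁻ v) s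
    reg∖⇒bounded {v} (_ , max) S⊆ nz = max _ (_ , (λ {u} → ⊆V∖ S⊆ {u}) ,
      nonzero⇒H̃ (face-∖⁻ ∘ ind⇒face) (face⇒ind ∘ face-∖⁺ (⊆V∖ S⊆)) nz)

    bounded⇒reg∖ : ∀ {v S s} → S ⊆ V Γ ⁻ v → Nonzero Γ S s → Bounded Γ (V Γ ⁻ v) s → HasReg (Γ ∖ v) s
    bounded⇒reg∖ {v} S⊆ nz bound =
      (_ , (λ {u} → ⊆V∖ S⊆ {u}) , nonzero⇒H̃ (face-∖⁻ ∘ ind⇒face) (face⇒ind ∘ face-∖⁺ (⊆V∖ S⊆)) nz)
      , λ j (S , S⊆′ , H) → bound (≡.subst (_ ∈_) (V∖≡V⁻ Γ) ∘ S⊆′)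
          (H̃⇒nonzero (face-∖⁻ ∘ ind⇒face) (face⇒ind ∘ face-∖⁺ S⊆′) H)

  -- Prime graphs in terms of nonzero homology

  record Critical (Γ : Graph n) (r : ℕ) : Set (c ⊔ ℓ) where
    field
      bounded  : Bounded Γ (V Γ) (suc r)
      bounded⁻ : ∀ {v} → v ∈ V Γ → Bounded Γ (V Γ ⁻ v) r
      nonzero  : Nonzero Γ (V Γ) (suc r)

    -- The class in degree `suc r` does not fit on `V Γ ⁻ v`, so it descends to the link of `v`.
    nonzero-lk : ∀ {v} → v ∈ V Γ → Nonzero Γ (lk Γ (V Γ) v) r
    nonzero-lk v∈V = nonzero-link v∈V v∈V nonzero λ nz → 1+n≰n (bounded⁻ v∈V (λ u∈ → u∈) nz)

  module _ (Γ : Graph n) where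

    prime⇒critical : ∀ {v} → v ∈ V Γ → Prime 𝕜 Γ → ∃[ r ] Critical Γ r
    prime⇒critical v∈V (_ , drop) with drop _ v∈V
    -- The strict drop at a vertex makes the regularity positive.
    ... | _ , suc r , _ , reg≐r , _ = r , record
      { bounded  = reg⇒bounded reg≐r
      ; bounded⁻ = bounded⁻
      ; nonzero  = nonzero
      }
      where
      bounded⁻ : ∀ {v} → v ∈ V Γ → Bounded Γ (V Γ ⁻ v) r
      bounded⁻ v∈V with drop _ v∈V
      -- Primality names the regularity of `Γ` afresh at each vertex; a class attaining `r′` shows
      -- `r′ ≤ suc r`.
      ... | s , r′ , reg∖≐s , reg≐r′ , s<r′ = λ S⊆ nz →
        let (_ , S′⊆ , nz′) = reg⇒nonzero {Γ = Γ} reg≐r′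
        in ≤-pred (≤-trans (s≤s (reg∖⇒bounded reg∖≐s S⊆ nz)) (≤-trans s<r′ (reg⇒bounded reg≐r S′⊆ nz′)))

      -- A set attaining the maximum contains every vertex, since a missed vertex `v` would leave
      -- the class to `V Γ ⁻ v`, where degrees are at most `r`.
      nonzero : Nonzero Γ (V Γ) (suc r)
      nonzero with reg⇒nonzero {Γ = Γ} reg≐r
      ... | S , S⊆V , nz = ≡.subst (λ T → Nonzero Γ T (suc r)) (⊆-antisym S⊆V V⊆S) nz
        where
        V⊆S : V Γ ⊆ S
        V⊆S {v} v∈V with v ∈? S
        ... | yes v∈S = v∈S
        ... | no  v∉S = ⊥-elim (1+n≰n (bounded⁻ v∈V (⊆⇒⊆⁻ S⊆V v∉S) nz))

  -- The regularity of ℒ(G) and of its vertex deletions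

  module CriticalLozin {n : ℕ} (G : Graph n) (conn : Connected G) {r : ℕ} (critical : Critical G r)
           (x : Fin n) (x∈V : x ∈ V G)
           (Y Z : Subset n) (N≡Y∪Z : N G x ≡ Y ∪ Z) (Y≠∅ : Nonempty Y) (Z≠∅ : Nonempty Z) where
    open LozinGraph G x x∈V Y Z N≡Y∪Z
    open LozinHomology G x x∈V Y Z N≡Y∪Z
    open LozinBounds G x x∈V Y Z N≡Y∪Z
    open Critical critical

    private
      W R : Subset n
      W = V G ⁻ x
      R = lk G (V G) x

      x∉W : x ∉ W
      x∉W = v∉S⁻v x (V G)

      bounded-W : Bounded G W r
      bounded-W = bounded⁻ x∈V

      VL : V L ≡ full W
      VL = ≡.cong (λ S → full S) (V∖≡V⁻ G)

      reg-L : HasReg L (suc (suc r))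
      reg-L = bounded⇒reg {Γ = L} {S = V L} (λ u∈ → u∈)
        (≡.subst (λ T → Nonzero L T (suc (suc r))) (≡.sym VL) (nonzero-lozin x∉W
          (≡.subst (λ T → Nonzero G T (suc r)) (≡.sym (⁻⁺-cancel x∈V)) nonzero)))
        (≡.subst (λ T → Bounded L T (suc (suc r))) (≡.sym VL) (bounded-full x∈V bounded))

      R⊆W : R ⊆ W
      R⊆W = ∈lk⇒∈⁻ {Γ = G}

      x≢ : ∀ {u} → Graph._~_ G x u → x ≢ u
      x≢ x~u x≡u = Graph.~-irrefl G x≡u x~u

      nonzero-𝕒𝕓 : ∀ {S} → x ∉ S → Nonzero G S r →
                   Nonzero L (outside ∷ inside ∷ inside ∷ outside ∷ S) (suc r)
      nonzero-𝕒𝕓 x∉S nz = nonzero-edge {p = 𝕒} {q = 𝕓} (fwd ab)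
        (λ { (there ()) }) (λ { (there (there ())) })
        (λ { (lift _) (fwd ()) ; (lift _) (bwd ()) }) (λ { (lift _) (fwd ()) ; (lift _) (bwd ()) })
        (nonzero-extend x∉S nz)

      -- The link `R` of `x` misses `Y`, so the edge `𝕪𝕒` is disjoint from `R` and not joined to it;
      -- `nonzero-𝕓𝕫` uses `Z` in the same way.
      nonzero-𝕪𝕒 : Nonzero L (inside ∷ inside ∷ outside ∷ outside ∷ R) (suc r)
      nonzero-𝕪𝕒 = nonzero-edge {p = 𝕪} {q = 𝕒} (fwd ya) (λ ()) (λ { (there ()) })
        (λ { (lift u∈R) (fwd (yY u∈Y)) → lk-≁ G u∈R (∈Y⇒~ u∈Y) ; (lift _) (bwd ()) })
        (λ { (lift _) (fwd ()) ; (lift _) (bwd ()) })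
        (nonzero-extend (x∉W ∘ R⊆W) (nonzero-lk x∈V))

      nonzero-𝕓𝕫 : Nonzero L (outside ∷ outside ∷ inside ∷ inside ∷ R) (suc r)
      nonzero-𝕓𝕫 = nonzero-edge {p = 𝕓} {q = 𝕫} (fwd bz)
        (λ { (there (there ())) }) (λ { (there (there (there ()))) })
        (λ { (lift _) (fwd ()) ; (lift _) (bwd ()) })
        (λ { (lift u∈R) (fwd (zZ u∈Z)) → lk-≁ G u∈R (∈Z⇒~ u∈Z) ; (lift _) (bwd ()) })
        (nonzero-extend (x∉W ∘ R⊆W) (nonzero-lk x∈V))

      -- Deleting `𝕫` isolates `𝕓`. The link of `𝕫` is bounded through a vertex `u` of `Z`, because
      -- `G` is critical at `u`; `bounded-𝕪𝕒𝕫` mirrors this with a vertex of `Y`.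
      bounded-𝕪𝕓𝕫 : Bounded L (inside ∷ outside ∷ inside ∷ inside ∷ W) (suc r)
      bounded-𝕪𝕓𝕫 = let (u , u∈Z) = Z≠∅ ; u∈V = Graph.~⇒∈V G (Graph.~-sym G (∈Z⇒~ u∈Z)) in
        bounded-vertex {v = 𝕫} (there (there (there here))) (bounded-𝕪𝕓 x∉W bounded-W)
          (bounded-lk-𝕫 (x≢ (∈Z⇒~ u∈Z)) (bounded⁻ u∈V) u∈Z)

      bounded-𝕪𝕒𝕫 : Bounded L (inside ∷ inside ∷ outside ∷ inside ∷ W) (suc r)
      bounded-𝕪𝕒𝕫 = let (u , u∈Y) = Y≠∅ ; u∈V = Graph.~⇒∈V G (Graph.~-sym G (∈Y⇒~ u∈Y)) in
        bounded-vertex {v = 𝕪} here (bounded-𝕒𝕫 x∉W bounded-W)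
          (bounded-lk-𝕪 (x≢ (∈Y⇒~ u∈Y)) (bounded⁻ u∈V) u∈Y)

      old-bounded : ∀ {u} → u ∈ V G → u ≢ x → Bounded L (full (W ⁻ u)) (suc r)
      old-bounded u∈V u≢x = bounded-⊆
        (⊆full λ w∈ → ∈⇒∈⁻ (∈⇒∈⁻ (∈⁻⇒∈ (∈⁻⇒∈ w∈)) (∈⁻⇒≢ w∈)) (∈⁻⇒≢ (∈⁻⇒∈ w∈)))
        (bounded-full (∈⇒∈⁻ x∈V λ x≡u → u≢x (≡.sym x≡u)) (bounded⁻ u∈V))

      -- The link of `u` in `G` has a class in degree `r`. If the link contains `x`, passing to its
      -- Lozin transform raises the degree; otherwise the disjoint edge `𝕒𝕓` does.
      old-nonzero : ∀ {u} → u ∈ V G → ∃[ S ] S ⊆ full (W ⁻ u) × Nonzero L S (suc r)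
      old-nonzero {u} u∈V with x ∈? lk G (V G) u
      ... | yes x∈ = _ , ⊆full (λ w∈ → ∈⇒∈⁻ (∈⇒∈⁻ (lk⊆ G (∈⁻⇒∈ w∈)) (∈⁻⇒≢ w∈)) (lk-≢ G (∈⁻⇒∈ w∈)))
          , nonzero-lozin (v∉S⁻v x _)
            (≡.subst (λ T → Nonzero G T r) (≡.sym (⁻⁺-cancel x∈)) (nonzero-lk u∈V))
      ... | no  x∉ = _ , ⊆full (λ w∈ → ∈⇒∈⁻ (∈⇒∈⁻ (lk⊆ G w∈) λ { ≡.refl → x∉ w∈ }) (lk-≢ G w∈))
          , nonzero-𝕒𝕓 x∉ (nonzero-lk u∈V)

      reg-∖ : ∀ v {S} → S ⊆ full W ⁻ v → Nonzero L S (suc r) → Bounded L (full W ⁻ v) (suc r) →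
              HasReg (L ∖ v) (suc r)
      reg-∖ v {S} S⊆ nz bound = bounded⇒reg∖ (≡.subst (λ T → S ⊆ T ⁻ v) (≡.sym VL) S⊆) nz
        (≡.subst (λ T → Bounded L (T ⁻ v) (suc r)) (≡.sym VL) bound)

      reg-L∖ : ∀ v → v ∈ V L → HasReg (L ∖ v) (suc r)
      reg-L∖ 𝕪 _ = reg-∖ 𝕪
        (λ { (there here) → there here ; (there (there here)) → there (there here)
           ; (lift u∈) → lift (R⊆W u∈) })
        (nonzero-𝕒𝕓 (x∉W ∘ R⊆W) (nonzero-lk x∈V)) (bounded-𝕒𝕓𝕫 x∉W bounded-W)
      reg-L∖ 𝕒 _ = reg-∖ 𝕒
        (λ { (there (there here)) → there (there here)
           ; (there (there (there here))) → there (there (there here))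
           ; (lift u∈) → lift (R⊆W u∈) })
        nonzero-𝕓𝕫 bounded-𝕪𝕓𝕫
      reg-L∖ 𝕓 _ = reg-∖ 𝕓
        (λ { here → here ; (there here) → there here ; (lift u∈) → lift (R⊆W u∈) }) nonzero-𝕪𝕒 bounded-𝕪𝕒𝕫
      reg-L∖ 𝕫 _ = reg-∖ 𝕫
        (λ { (there here) → there here ; (there (there here)) → there (there here)
           ; (lift u∈) → lift (R⊆W u∈) })
        (nonzero-𝕒𝕓 (x∉W ∘ R⊆W) (nonzero-lk x∈V)) (bounded-𝕪𝕒𝕓 x∉W bounded-W)
      reg-L∖ (old u) (lift u∈) with old-nonzero (∈V∖⇒∈V G u∈)
      ... | S , S⊆ , nz = reg-∖ (old u) S⊆ nz (old-bounded (∈V∖⇒∈V G u∈) (∈V∖⇒≢ G u∈))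

    lozin-prime : Prime 𝕜 L
    lozin-prime = connected conn , λ v v∈ → suc r , suc (suc r) , reg-L∖ v v∈ , reg-L , ≤-refl

mainTheorem15 : ∀ {c ℓ : Level} (𝕜 : Field c ℓ) {n : ℕ} (G : Graph n) →
    Prime 𝕜 G → 2 ≤ Graph.δ G →
    (x : Fin n) → x ∈ Graph.V G →
    (Y Z : Subset n) (N≡Y∪Z : Graph.N G x ≡ Y ∪ Z) → Empty (Y ∩ Z) →
    Nonempty Y → Nonempty Z →
    Prime 𝕜 (Lozin G x Y Z N≡Y∪Z)
mainTheorem15 𝕜 G prime _ x x∈V Y Z N≡Y∪Z _ Y≠∅ Z≠∅ =
  CriticalLozin.lozin-prime G (proj₁ prime) (proj₂ (prime⇒critical G x∈V prime)) x x∈V Y Z N≡Y∪Z Y≠∅ Z≠∅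
  where open Homology 𝕜
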